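{- Let $w$ be a positive integer whose binary representation has length $n$, and let $\pi^*$ be the self-inverting permutation of length $n^*=2n+1$ produced by the algorithm Encode_W.to.SiP to encode $w$. The algorithm Decode_SiP.to.W correctly extracts $w$ from $\pi^*$ in $O(n^*)=O(n)$ time and space.
   Context: For $m\ge 1$ let $N_m=\{1,2,\ldots,m\}$. A permutation $\pi=(\pi_1,\ldots,\pi_m)$ over $N_m$ is written as a sequence; its length is $m$. It is self-inverting if $\pi_{\pi_i}=i$ for all $i$; equivalently all its cycles have length 1 or 2. A 2-cycle is written $(x,y)$ with $x>y$ and a 1-cycle is written $(x)$ or $(x,x)$. $\|$ denotes concatenation (of sequences or of binary strings) and $Y^R$ denotes the reverse of the sequence $Y$. Decreasing cycle representation: the sequence $C=((a_1,b_1),\ldots,(a_r,b_r))$ of all 1- and 2-cycles of a self-inverting permutation, each written with $a_i\ge b_i$, ordered so that $b_1>b_2>\cdots>b_r$. Algorithm Encode_W.to.SiP (input: $w$; output: $\pi^*$): 1. Compute the binary representation $B$ of $w$ and let $n$ be its length (so the leading bit of $B$ is 1). 2. Construct the binary number $B'=\underbrace{00\cdots0}_{n}\,\|\,B\,\|\,0$ of length $n^*=2n+1$, and let $B^*$ be the sequence of its bits, at positions $1,\ldots,n^*$. 3. Let $X=(x_1,\ldots,x_k)$ be the sequence of positions of the 1s in $B^*$ and $Y=(y_1,\ldots,y_m)$ the sequence of positions of the 0s in $B^*$, both from left to right, where $k+m=n^*$. 4. Let $\pi^b=X\|Y^R=(x_1,\ldots,x_k,y_m,y_{m-1},\ldots,y_1)$.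 5. For $i=1,\ldots,n$ form the 2-cycle $(\pi^b_i,\pi^b_{n^*-i+1})$; form also the 1-cycle $(\pi^b_{n+1})$. 6. Initialize $\pi^*$ to the identity permutation $(1,2,\ldots,2n+1)$; for each 2-cycle $(p,q)$ of Step 5 set $\pi^*_{p}=q$ and $\pi^*_{q}=p$. 7. Return $\pi^*$. Algorithm Decode_SiP.to.W (input: $\pi^*$ of length $n^*=2n+1$; output: an integer): 1. Compute the decreasing cycle representation $C=((a_1,b_1),\ldots,(a_{n+1},b_{n+1}))$ of $\pi^*$, with $a_i\ge b_i$ and $b_1>b_2>\cdots>b_{n+1}$. 2. Form $Q=(a_{n+1},a_n,\ldots,a_2,a_1,b_1,b_2,\ldots,b_{n+1})$, delete from $Q$ the entry $a_i$ of the 1-cycle $(a_i,b_i)$ (the one with $a_i=b_i$), and let $\pi^b=(\pi^b_1,\ldots,\pi^b_{n^*})$ be the resulting sequence. 3. Let $\pi^b_{k+1}$ be the maximum element of $\pi^b$; let $X=(\pi^b_1,\ldots,\pi^b_k)$ and $Y=(\pi^b_{k+1},\ldots,\pi^b_{n^*})$. 4. Construct the binary sequence of length $n^*$ that has 1 in positions $\pi^b_1,\ldots,\pi^b_k$ and 0 in positions $\pi^b_{k+1},\ldots,\pi^b_{n^*}$. 5. Let $B'=b'_1b'_2\cdots b'_{n^*}$ be the corresponding binary number. 6. Return the value of the binary number $b'_{n+1}b'_{n+2}\cdots b'_{n^*-1}$. Time and space are counted in the usual unit-cost RAM sense: elementary operations on integers of size $O(n)$ and on sequence entries have unit cost, and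 $w$ is input/output by its bits. -}

module Defs where

open import Data.Bool.Base using (Bool; true; false; not; if_then_else_)
open import Data.Digit using (Bit; 0b; 1b; fromDigits; toDigits)
open import Data.Fin.Base using (Fin)
open import Data.Fin using (#_)
import Data.Fin.Properties as Fin
open import Data.List.Base using (List; []; _∷_; [_]; _++_; map; filter; zip;
  reverse; foldl; length; replicate; take; drop; takeWhile; dropWhile;
  concatMap; applyUpTo; applyDownFrom)
open import Data.List.Extrema.Nat using (max)
open import Data.List.Membership.DecPropositional using (_∈?_)
open import Data.Nat.Base using (ℕ; zero; suc; _+_; _*_; _∸_; _⊔_; ⌊_/2⌋;
  _≤ᵇ_; _<ᵇ_; _≡ᵇ_; _≤_)
open import Data.Nat.Properties using (_≟_; _≤?_)
open import Data.Product.Base using (_×_; _,_; proj₁; proj₂)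
open import Data.Vec.Functional using (Vector; updateAt)
open import Function.Base using (_∘_; const)
open import Relation.Binary.PropositionalEquality.Core using (_≡_)
open import Relation.Nullary.Decidable using (Dec; does; ¬?; _×-dec_)

------------------------------------------------------------------------
-- Sequences are lists whose entries are numbered from 1.  A permutation
-- π of {1,…,m} is the list (π₁,…,πₘ).

infixl 8 _!_

-- The value 0 at positions outside 1,…,length xs is junk.
_!_ : List ℕ → ℕ → ℕ
[]       ! _             = 0
(x ∷ xs) ! zero          = 0
(x ∷ xs) ! suc zero      = x
(x ∷ xs) ! suc (suc p)   = xs ! suc p

_[_↦_] : List ℕ → ℕ → ℕ → List ℕ
[]       [ _           ↦ v ] = []
(x ∷ xs) [ zero        ↦ v ] = x ∷ xs
(x ∷ xs) [ suc zero    ↦ v ] = v ∷ xs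
(x ∷ xs) [ suc (suc p) ↦ v ] = x ∷ (xs [ suc p ↦ v ])

-- (1, 2, …, m)
1⋯ : ℕ → List ℕ
1⋯ = applyUpTo suc

------------------------------------------------------------------------
-- Binary numbers, most significant bit first (the library's digit
-- expansions are least significant first).

value : List Bit → ℕ
value = fromDigits ∘ reverse

-- Removing leading zeros makes the leading bit 1 whenever w > 0.
binary : ℕ → List Bit
binary w = dropWhile (Fin._≟ 0b) (reverse (proj₁ (toDigits 2 w)))

------------------------------------------------------------------------
-- Encode_W.to.SiP

positions : Bit → List Bit → List ℕ
positions d ds =
  map proj₁ (filter (λ pd → proj₂ pd Fin.≟ d) (zip (1⋯ (length ds)) ds))

-- X ‖ Yᴿ
bitonic : List Bit → List ℕ
bitonic B* = positions 1b B* ++ reverse (positions 0b B*)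

-- The 1-cycle (πᵇₙ₊₁) is omitted: π* is initially the identity and the
-- 1-cycle is not assigned.
2-cycles : ℕ → List ℕ → List (ℕ × ℕ)
2-cycles n πᵇ = map (λ i → πᵇ ! i , πᵇ ! (2 * n + 1 ∸ i + 1)) (1⋯ n)

setCycle : List ℕ → ℕ × ℕ → List ℕ
setCycle π (p , q) = (π [ p ↦ q ]) [ q ↦ p ]

encodeBits : List Bit → List ℕ
encodeBits B = foldl setCycle (1⋯ (2 * n + 1)) (2-cycles n (bitonic B*))
  where
  n  = length B
  B* = replicate n 0b ++ B ++ [ 0b ]

encode : ℕ → List ℕ
encode = encodeBits ∘ binary

------------------------------------------------------------------------
-- Decode_SiP.to.W, as a function

-- (x , y) is a cycle of π written with x ≥ y; x = y for a 1-cycle.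
IsCycle : List ℕ → ℕ × ℕ → Set
IsCycle π (x , y) = y ≤ x × π ! x ≡ y × π ! y ≡ x

isCycle? : ∀ π xy → Dec (IsCycle π xy)
isCycle? π (x , y) = y ≤? x ×-dec π ! x ≟ y ×-dec π ! y ≟ x

-- All cycles in {1,…,l} × {1,…,l}, by decreasing second entry.
decreasingCycles : List ℕ → List (ℕ × ℕ)
decreasingCycles π =
  filter (isCycle? π)
         (concatMap (λ y → map (_, y) (1⋯ l)) (reverse (1⋯ l)))
  where l = length π

-- (aₙ₊₁,…,a₁,b₁,…,bₙ₊₁) without the a-entry of the 1-cycle
unfoldCycles : List (ℕ × ℕ) → List ℕ
unfoldCycles C = reverse (map proj₁ (filter (λ ab → ¬? (proj₁ ab ≟ proj₂ ab)) C))
                 ++ map proj₂ C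

beforeMax : List ℕ → List ℕ
beforeMax πᵇ = takeWhile (λ x → ¬? (x ≟ max 0 πᵇ)) πᵇ

-- Positions outside X are exactly those of Y, since X ‖ Y is a
-- permutation of 1,…,m.
indicator : ℕ → List ℕ → List Bit
indicator m X = map (λ p → if does (_∈?_ _≟_ p X) then 1b else 0b) (1⋯ m)

-- (b′ₙ₊₁,…,b′₂ₙ), where the length of π is 2n + 1
decodeBits : List ℕ → List Bit
decodeBits π = take n (drop n B′)
  where
  n  = ⌊ length π /2⌋
  B′ = indicator (length π) (beforeMax (unfoldCycles (decreasingCycles π)))

decode : List ℕ → ℕ
decode = value ∘ decodeBits

------------------------------------------------------------------------
-- A unit-cost RAM, with a fixed number of scalar registers and of
-- unbounded arrays of natural numbers.

record Cost : Set where
  constructor mkCost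
  field
    time   : ℕ
    extent : ℕ   -- largest array index accessed
    size   : ℕ   -- largest number handled

open Cost public

infixr 6 _⊕_

_⊕_ : Cost → Cost → Cost
mkCost t e s ⊕ mkCost t′ e′ s′ = mkCost (t + t′) (e ⊔ e′) (s ⊔ s′)

-- One elementary operation producing v, without or with an access to
-- the array cell of index k.
op : ℕ → Cost
op v = mkCost 1 0 v

access : (k v : ℕ) → Cost
access k v = mkCost 1 k v

ascending descending : ℕ → ℕ → List ℕ
ascending  lo hi = applyUpTo (lo +_) (suc hi ∸ lo)
descending hi lo = applyDownFrom (lo +_) (suc hi ∸ lo)

module RAM (#scalars #arrays : ℕ) where

  Scalar = Fin #scalars
  Array  = Fin #arrays

  infix  9 _⟨_⟩
  infixl 8 _⊞_ _⊟_
  infix  7 _≤ᵗ_ _<ᵗ_ _≠ᵗ_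
  infix  6 _≔_ _⟨_⟩≔_
  infix  5 when_then_ for_from_upto_loop_ for_from_downto_loop_
  infixr 4 _⨾_

  data Expr : Set where
    lit     : ℕ → Expr
    var     : Scalar → Expr
    _⟨_⟩    : Array → Expr → Expr
    _⊞_ _⊟_ : Expr → Expr → Expr

  data Test : Set where
    _≤ᵗ_ _<ᵗ_ _≠ᵗ_ : Expr → Expr → Test

  data Cmd : Set where
    _≔_                    : Scalar → Expr → Cmd
    _⟨_⟩≔_                 : Array → Expr → Expr → Cmd
    _⨾_                    : Cmd → Cmd → Cmd
    when_then_             : Test → Cmd → Cmd
    for_from_upto_loop_    : Scalar → Expr → Expr → Cmd → Cmd
    for_from_downto_loop_  : Scalar → Expr → Expr → Cmd → Cmd

  record State : Set where
    field
      scalar : Vector ℕ #scalars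
      cell   : Vector (ℕ → ℕ) #arrays

  open State public

  setScalar : Scalar → ℕ → State → State
  setScalar x v σ = record σ { scalar = updateAt (scalar σ) x (const v) }

  setCell : Array → ℕ → ℕ → State → State
  setCell a k v σ = record σ
    { cell = updateAt (cell σ) a λ f j → if j ≡ᵇ k then v else f j }

  ⟦_⟧ : Expr → State → ℕ
  ⟦ lit k  ⟧ σ = k
  ⟦ var x  ⟧ σ = scalar σ x
  ⟦ a ⟨ e ⟩ ⟧ σ = cell σ a (⟦ e ⟧ σ)
  ⟦ e ⊞ f  ⟧ σ = ⟦ e ⟧ σ + ⟦ f ⟧ σ
  ⟦ e ⊟ f  ⟧ σ = ⟦ e ⟧ σ ∸ ⟦ f ⟧ σ

  holds : Test → State → Bool
  holds (e ≤ᵗ f) σ = ⟦ e ⟧ σ ≤ᵇ ⟦ f ⟧ σ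
  holds (e <ᵗ f) σ = ⟦ e ⟧ σ <ᵇ ⟦ f ⟧ σ
  holds (e ≠ᵗ f) σ = not (⟦ e ⟧ σ ≡ᵇ ⟦ f ⟧ σ)

  iterate : (ℕ → State → State) → List ℕ → State → State
  iterate body vs σ = foldl (λ τ v → body v τ) σ vs

  -- The bounds of a loop are evaluated once, on entry.
  exec : Cmd → State → State
  exec (x ≔ e)                        σ = setScalar x (⟦ e ⟧ σ) σ
  exec (a ⟨ e ⟩≔ f)                   σ = setCell a (⟦ e ⟧ σ) (⟦ f ⟧ σ) σ
  exec (c ⨾ d)                        σ = exec d (exec c σ)
  exec (when t then c)                σ = if holds t σ then exec c σ else σ
  exec (for x from e upto f loop c)   σ =
    iterate (λ v τ → exec c (setScalar x v τ)) (ascending (⟦ e ⟧ σ) (⟦ f ⟧ σ)) σ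
  exec (for x from e downto f loop c) σ =
    iterate (λ v τ → exec c (setScalar x v τ)) (descending (⟦ e ⟧ σ) (⟦ f ⟧ σ)) σ

  costᵉ : Expr → State → Cost
  costᵉ (lit k)  σ = op k
  costᵉ (var x)  σ = op (scalar σ x)
  costᵉ (a ⟨ e ⟩) σ = costᵉ e σ ⊕ access (⟦ e ⟧ σ) (⟦ a ⟨ e ⟩ ⟧ σ)
  costᵉ (e ⊞ f)  σ = costᵉ e σ ⊕ costᵉ f σ ⊕ op (⟦ e ⊞ f ⟧ σ)
  costᵉ (e ⊟ f)  σ = costᵉ e σ ⊕ costᵉ f σ ⊕ op (⟦ e ⊟ f ⟧ σ)

  costᵗ : Test → State → Cost
  costᵗ (e ≤ᵗ f) σ = costᵉ e σ ⊕ costᵉ f σ ⊕ op 0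
  costᵗ (e <ᵗ f) σ = costᵉ e σ ⊕ costᵉ f σ ⊕ op 0
  costᵗ (e ≠ᵗ f) σ = costᵉ e σ ⊕ costᵉ f σ ⊕ op 0

  -- Every iteration pays for updating and testing the counter; leaving
  -- the loop pays for the last test.
  iterateCost : (ℕ → State → State) → (ℕ → State → Cost) → List ℕ → State → Cost
  iterateCost body cost []       σ = op 0
  iterateCost body cost (v ∷ vs) σ =
    op v ⊕ op 0 ⊕ cost v σ ⊕ iterateCost body cost vs (body v σ)

  cost : Cmd → State → Cost
  cost (x ≔ e)                        σ = costᵉ e σ ⊕ op (⟦ e ⟧ σ)
  cost (a ⟨ e ⟩≔ f)                   σ = costᵉ e σ ⊕ costᵉ f σ ⊕ access (⟦ e ⟧ σ) (⟦ f ⟧ σ)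
  cost (c ⨾ d)                        σ = cost c σ ⊕ cost d (exec c σ)
  cost (when t then c)                σ = costᵗ t σ ⊕ (if holds t σ then cost c σ else op 0)
  cost (for x from e upto f loop c)   σ =
    costᵉ e σ ⊕ costᵉ f σ ⊕
    iterateCost (λ v τ → exec c (setScalar x v τ)) (λ v τ → cost c (setScalar x v τ))
                (ascending (⟦ e ⟧ σ) (⟦ f ⟧ σ)) σ
  cost (for x from e downto f loop c) σ =
    costᵉ e σ ⊕ costᵉ f σ ⊕
    iterateCost (λ v τ → exec c (setScalar x v τ)) (λ v τ → cost c (setScalar x v τ))
                (descending (⟦ e ⟧ σ) (⟦ f ⟧ σ)) σ

  -- Every array occupies the cells 0,…,extent.  Loop bounds and
  -- intermediate values of expressions are not counted: they take a
  -- number of cells fixed by the program text.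
  space : Cost → ℕ
  space κ = #scalars + #arrays * suc (extent κ)

------------------------------------------------------------------------
-- Decode_SiP.to.W, as a RAM program

module DecodeRAM where

  open RAM 6 6 public

  n* n i r m p : Scalar
  n* = # 0
  n  = # 1
  i  = # 2
  r  = # 3   -- number of cycles found so far
  m  = # 4   -- number of entries of πᵇ written so far
  p  = # 5   -- position of the largest entry of πᵇ seen so far

  π a b πᵇ B′ out : Array
  π   = # 0
  a   = # 1
  b   = # 2
  πᵇ  = # 3
  B′  = # 4
  out = # 5

  findCycles buildBitonic findMax markBits writeResult program : Cmd

  -- In a self-inverting permutation the cycle of i is {πᵢ, i}, and it
  -- is recorded when i is its smaller entry.
  findCycles =
    r ≔ lit 0 ⨾
    (for i from var n* downto lit 1 loop
      when var i ≤ᵗ π ⟨ var i ⟩ then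
        ( r ≔ var r ⊞ lit 1 ⨾
          a ⟨ var r ⟩≔ π ⟨ var i ⟩ ⨾
          b ⟨ var r ⟩≔ var i ))

  buildBitonic =
    m ≔ lit 0 ⨾
    (for i from var r downto lit 1 loop
      when a ⟨ var i ⟩ ≠ᵗ b ⟨ var i ⟩ then
        ( m ≔ var m ⊞ lit 1 ⨾
          πᵇ ⟨ var m ⟩≔ a ⟨ var i ⟩ )) ⨾
    (for i from lit 1 upto var r loop
      ( m ≔ var m ⊞ lit 1 ⨾
        πᵇ ⟨ var m ⟩≔ b ⟨ var i ⟩ ))

  findMax =
    p ≔ lit 1 ⨾
    (for i from lit 2 upto var n* loop
      when πᵇ ⟨ var p ⟩ <ᵗ πᵇ ⟨ var i ⟩ then p ≔ var i)

  markBits =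
    (for i from lit 1 upto var p ⊟ lit 1 loop
      B′ ⟨ πᵇ ⟨ var i ⟩ ⟩≔ lit 1) ⨾
    (for i from var p upto var n* loop
      B′ ⟨ πᵇ ⟨ var i ⟩ ⟩≔ lit 0)

  -- The r = n + 1 cycles determine n.
  writeResult =
    n ≔ var r ⊟ lit 1 ⨾
    (for i from var n ⊞ lit 1 upto var n* ⊟ lit 1 loop
      out ⟨ var i ⊟ var n ⟩≔ B′ ⟨ var i ⟩)

  program = findCycles ⨾ buildBitonic ⨾ findMax ⨾ markBits ⨾ writeResult

  input : List ℕ → State
  input xs = record
    { scalar = updateAt (const 0) n* (const (length xs))
    ; cell   = updateAt (const (const 0)) π (const (xs !_)) }

  output : State → List ℕ
  output σ = applyUpTo (λ j → cell σ out (suc j)) (scalar σ n)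

{-# OPTIONS --safe #-}

-- All 1s of B* lie among the places n + 1, …, 2n, so πᵇ ends with
-- n, …, 1 and the i-th 2-cycle is (πᵇᵢ , i) for i ≤ n, where πᵇᵢ > n.
-- Hence y ≤ π*(y) holds exactly for the fixed point and for y ≤ n, the
-- smaller entries of the cycles are read in the order πᵇₙ₊₁, n, …, 1, and
-- unfolding the cycles gives back πᵇ.  Its largest entry 2n + 1 is the
-- position of the appended 0, which is the first entry of Yᴿ; so the
-- entries before it are the positions of the 1s.
--
-- For the resources no loop needs to be understood: a body without loops
-- takes constant time and increases the largest number in the memory by
-- at most a constant, and no two loops are nested.

module Submission where

open import Data.Bool.Base using (true; false; not; if_then_else_)
open import Data.Digit using (Bit; 0b; 1b; fromDigits; toDigits)
open import Data.Fin.Base using (toℕ; zero; suc)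
import Data.Fin.Properties as Fin
open import Data.List.Base hiding (head; updateAt; iterate)
open import Data.List.Properties
open import Data.List.Extrema.Nat using (max; max≈v⁺)
open import Data.List.Membership.Propositional using (_∈_; _∉_)
open import Data.List.Membership.Propositional.Properties
open import Data.List.Membership.DecPropositional using (_∈?_)
open import Data.List.Relation.Binary.Permutation.Propositional
  using (_↭_; ↭-refl; ↭-trans; ↭-sym; prep; ↭⇒↭ₛ)
open import Data.List.Relation.Binary.Permutation.Propositional.Properties
  using (shift; ↭-reverse; ++⁺ˡ; ∈-resp-↭; ↭-length; All-resp-↭)
import Data.List.Relation.Binary.Permutation.Setoid.Properties as ↭ₛ
open import Data.List.Relation.Unary.All as All using (All; []; _∷_)
import Data.List.Relation.Unary.All.Properties as All
open import Data.List.Relation.Unary.AllPairs as AllPairs using (AllPairs; []; _∷_)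
import Data.List.Relation.Unary.AllPairs.Properties as AllPairs
open import Data.List.Relation.Unary.Any as Any using (here; there)
open import Data.List.Relation.Unary.Unique.Propositional using (Unique)
import Data.List.Relation.Unary.Unique.Propositional.Properties as Unique
open import Data.Nat.Base
open import Data.Nat.Properties
open import Data.Nat.Tactic.RingSolver using (solve-∀)
open import Data.Product.Base using (∃; ∃-syntax; _×_; _,_; proj₁; proj₂; map₂)
open import Data.Sum.Base using (inj₁; inj₂; [_,_]′)
open import Data.Vec.Functional using (Vector; updateAt)
open import Function.Base using (_∘_; const; id; case_of_)
open import Relation.Binary.PropositionalEquality hiding ([_])
open import Relation.Nullary using (¬_; Dec; yes; no; does; contradiction)
open import Relation.Nullary.Decidable using (dec-true; dec-false; ¬?)
open import Relation.Unary using (Decidable)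
open import Defs

-- Encoding and decoding cut the same sequence at different places. `encode` pairs entries around
-- the centre, so it sees n + 1 upper places followed by (n,...,1); `decode` cuts at the maximum, so
-- it sees X, then 2n + 1, then the rest. The first cut is blind to the bits: any arrangement of n +
-- 1,...,2n + 1 in front of (n,...,1) is recovered by unfolding its cycles, and `Pairing` proves
-- just this. Only afterwards does it matter that the arrangement comes from X ‖ Yᴿ.
--
-- The functional decoder searches all pairs for cycles, the program makes one descending pass. Both
-- reduce to the same filter because π* is an involution of its range; from there on the arrays are
-- compared with lists already computed for the decoder.
--
-- The resource bound needs two notions of growth. Additive growth (`Slow`), repeated O(V) times, is
-- still linear in V; multiplicative growth (`Linear`) stays linear only under a fixed number of
-- compositions. So loop bodies have to be `Slow`, and the program as a whole is `Linear`.

private variable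
  A C : Set
  x y : A
  xs ys : List A

-- Lists: uniqueness, filtering and cutting.

Unique-resp-↭ : xs ↭ ys → Unique xs → Unique ys
Unique-resp-↭ xs↭ys = ↭ₛ.Unique-resp-↭ (setoid _) (↭⇒↭ₛ xs↭ys)

Unique-++⇒disjoint : ∀ (xs : List A) {ys} → Unique (xs ++ ys) → x ∈ xs → x ∉ ys
Unique-++⇒disjoint (_ ∷ xs) (≢s ∷ _) (here refl) x∈ys = All.lookup ≢s (∈-++⁺ʳ xs x∈ys) refl
Unique-++⇒disjoint (_ ∷ xs) (_ ∷ u)  (there x∈xs)     = Unique-++⇒disjoint xs u x∈xs

Unique-++⁻ˡ : ∀ (xs : List A) {ys} → Unique (xs ++ ys) → Unique xs
Unique-++⁻ˡ []       _        = []
Unique-++⁻ˡ (x ∷ xs) (≢s ∷ u) = All.++⁻ˡ xs ≢s ∷ Unique-++⁻ˡ xs u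

Unique-++⁻ʳ : ∀ (xs : List A) {ys} → Unique (xs ++ ys) → Unique ys
Unique-++⁻ʳ []       u       = u
Unique-++⁻ʳ (x ∷ xs) (_ ∷ u) = Unique-++⁻ʳ xs u

applyUpTo-++ : ∀ (f : ℕ → A) m k → applyUpTo f (m + k) ≡ applyUpTo f m ++ applyUpTo (f ∘ (m +_)) k
applyUpTo-++ f zero    k = refl
applyUpTo-++ f (suc m) k = cong (f 0 ∷_) (applyUpTo-++ (f ∘ suc) m k)

module _ {P : A → Set} (P? : Decidable P) where

  -- Serves twice: for the only partner of a given y in a cycle, and for the only upper entry that
  -- is not above its image.
  filter-singleton : Unique xs → x ∈ xs → P x → (∀ {y} → y ∈ xs → P y → y ≡ x) → filter P? xs ≡ [ x ]
  filter-singleton {xs = _ ∷ xs} (≢s ∷ _) (here refl) px only =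
    trans (filter-accept P? px) (cong (_ ∷_) (filter-none P? (All.tabulate λ y∈xs py →
      All.lookup ≢s y∈xs (sym (only (there y∈xs) py)))))
  filter-singleton (≢s ∷ u) (there x∈xs) px only =
    trans (filter-reject P? λ py → All.lookup ≢s x∈xs (only (here refl) py))
          (filter-singleton u x∈xs px (only ∘ there))

  filter-∷ʳ : ∀ xs x → filter P? (xs ∷ʳ x) ≡ filter P? xs ++ filter P? [ x ]
  filter-∷ʳ xs x = filter-++ P? xs [ x ]

  filter-map-comm : (f : C → A) → ∀ xs → filter P? (map f xs) ≡ map f (filter (P? ∘ f) xs)
  filter-map-comm f []       = refl
  filter-map-comm f (x ∷ xs) with does (P? (f x))
  ... | true  = cong (f x ∷_) (filter-map-comm f xs)
  ... | false = filter-map-comm f xs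

  takeWhile-++-∷ : ∀ {y ys} → All P xs → ¬ P y → takeWhile P? (xs ++ y ∷ ys) ≡ xs
  takeWhile-++-∷ {y = y} [] ¬py rewrite dec-false (P? y) ¬py = refl
  takeWhile-++-∷ {xs = x ∷ xs} (px ∷ pxs) ¬py rewrite dec-true (P? x) px =
    cong (x ∷_) (takeWhile-++-∷ pxs ¬py)

filter-reverse : ∀ {P : A → Set} (P? : Decidable P) xs → filter P? (reverse xs) ≡ reverse (filter P? xs)
filter-reverse P? []       = refl
filter-reverse P? (x ∷ xs) rewrite unfold-reverse x xs | filter-++ P? (reverse xs) [ x ]
  with does (P? x)
... | true  = trans (cong (_++ [ x ]) (filter-reverse P? xs)) (sym (unfold-reverse x (filter P? xs)))
... | false = trans (++-identityʳ _) (filter-reverse P? xs)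

take-++ : ∀ (xs ys : List A) → take (length xs) (xs ++ ys) ≡ xs
take-++ []       ys = refl
take-++ (x ∷ xs) ys = cong (x ∷_) (take-++ xs ys)

drop-++ : ∀ (xs ys : List A) → drop (length xs) (xs ++ ys) ≡ ys
drop-++ []       ys = refl
drop-++ (x ∷ xs) ys = drop-++ xs ys

take-drop-middle : ∀ {n} (xs ys zs : List A) → length xs ≡ n → length ys ≡ n →
  take n (drop n (xs ++ ys ++ zs)) ≡ ys
take-drop-middle xs ys zs |xs|≡n refl = trans
  (cong (λ k → take (length ys) (drop k (xs ++ ys ++ zs))) (sym |xs|≡n))
  (trans (cong (take (length ys)) (drop-++ xs (ys ++ zs))) (take-++ ys zs))

-- Sequences with entries numbered from 1

∈-1⋯⁺ : ∀ {p m} → 0 < p → p ≤ m → p ∈ 1⋯ m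
∈-1⋯⁺ {suc p} _ p≤m = ∈-applyUpTo⁺ suc p≤m

∈-1⋯⁻ : ∀ {p m} → p ∈ 1⋯ m → 0 < p × p ≤ m
∈-1⋯⁻ p∈ with _ , i<m , refl ← ∈-applyUpTo⁻ suc p∈ = z<s , i<m

1⋯-unique : ∀ m → Unique (1⋯ m)
1⋯-unique m = Unique.applyUpTo⁺₁ suc m λ i<j _ → <⇒≢ (s<s i<j)

applyUpTo-! : ∀ xs → applyUpTo (λ i → xs ! suc i) (length xs) ≡ xs
applyUpTo-! []       = refl
applyUpTo-! (x ∷ xs) = cong (x ∷_) (applyUpTo-! xs)

map-! : ∀ xs → map (xs !_) (1⋯ (length xs)) ≡ xs
map-! xs = trans (map-applyUpTo suc (xs !_) _) (applyUpTo-! xs)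

!-applyUpTo : ∀ f {i m} → i < m → applyUpTo f m ! suc i ≡ f i
!-applyUpTo f {zero}  {suc _} _   = refl
!-applyUpTo f {suc i} {suc _} i<m = !-applyUpTo (f ∘ suc) (s<s⁻¹ i<m)

!-applyDownFrom : ∀ f i k → applyDownFrom f (suc (i + k)) ! suc i ≡ f k
!-applyDownFrom f zero    k = refl
!-applyDownFrom f (suc i) k = !-applyDownFrom f i k

!-∈ : ∀ xs {i} → i < length xs → xs ! suc i ∈ xs
!-∈ (x ∷ xs) {zero}  _   = here refl
!-∈ (x ∷ xs) {suc i} i<n = there (!-∈ xs (s<s⁻¹ i<n))

∈-! : ∀ {x} xs → x ∈ xs → ∃ λ i → i < length xs × xs ! suc i ≡ x
∈-! (x ∷ xs) (here refl)  = 0 , z<s , refl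
∈-! (_ ∷ xs) (there x∈xs) with i , i< , eq ← ∈-! xs x∈xs = suc i , s<s i< , eq

!-++ˡ : ∀ xs ys {i} → i < length xs → (xs ++ ys) ! suc i ≡ xs ! suc i
!-++ˡ (x ∷ xs) ys {zero}  _   = refl
!-++ˡ (x ∷ xs) ys {suc i} i<n = !-++ˡ xs ys (s<s⁻¹ i<n)

!-++ʳ : ∀ xs ys i → (xs ++ ys) ! (length xs + suc i) ≡ ys ! suc i
!-++ʳ []           ys i = refl
!-++ʳ (x ∷ [])     ys i = refl
!-++ʳ (x ∷ y ∷ xs) ys i = !-++ʳ (y ∷ xs) ys i

!-beyond : ∀ xs {i} → length xs ≤ i → xs ! suc i ≡ 0
!-beyond []       _           = refl
!-beyond (x ∷ xs) {suc i} n≤i = !-beyond xs (s≤s⁻¹ n≤i)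

!-injective : ∀ xs {i j} → Unique xs → i < length xs → j < length xs → xs ! suc i ≡ xs ! suc j → i ≡ j
!-injective (x ∷ xs) {zero}  {zero}  _        _  _  _  = refl
!-injective (x ∷ xs) {zero}  {suc j} (≢s ∷ _) _  j< eq = contradiction eq (All.lookup ≢s (!-∈ xs (s<s⁻¹ j<)))
!-injective (x ∷ xs) {suc i} {zero}  (≢s ∷ _) i< _  eq = contradiction (sym eq) (All.lookup ≢s (!-∈ xs (s<s⁻¹ i<)))
!-injective (x ∷ xs) {suc i} {suc j} (_ ∷ u)  i< j< eq = cong suc (!-injective xs u (s<s⁻¹ i<) (s<s⁻¹ j<) eq)

length-↦ : ∀ xs p v → length (xs [ p ↦ v ]) ≡ length xs
length-↦ []       p             v = refl
length-↦ (x ∷ xs) zero          v = refl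
length-↦ (x ∷ xs) (suc zero)    v = refl
length-↦ (x ∷ xs) (suc (suc p)) v = cong suc (length-↦ xs (suc p) v)

!-↦-same : ∀ xs {p v} → p ∈ 1⋯ (length xs) → (xs [ p ↦ v ]) ! p ≡ v
!-↦-same xs p∈ with _ , i<n , refl ← ∈-applyUpTo⁻ suc p∈ = go xs i<n
  where
  go : ∀ xs {i v} → i < length xs → (xs [ suc i ↦ v ]) ! suc i ≡ v
  go (x ∷ xs) {zero}  _   = refl
  go (x ∷ xs) {suc i} i<n = go xs (s<s⁻¹ i<n)

!-↦-other : ∀ xs {p q v} → q ≢ p → (xs [ p ↦ v ]) ! q ≡ xs ! q
!-↦-other []       _ = refl
!-↦-other (x ∷ xs) {zero}        {q}             _   = refl
!-↦-other (x ∷ xs) {suc zero}    {zero}          _   = refl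
!-↦-other (x ∷ xs) {suc zero}    {suc zero}      q≢p = contradiction refl q≢p
!-↦-other (x ∷ xs) {suc zero}    {suc (suc q)}   _   = refl
!-↦-other (x ∷ xs) {suc (suc p)} {zero}          _   = refl
!-↦-other (x ∷ xs) {suc (suc p)} {suc zero}      _   = refl
!-↦-other (x ∷ xs) {suc (suc p)} {suc (suc q)}   q≢p = !-↦-other xs (q≢p ∘ cong suc)

-- Assigning 2-cycles

_∉ᶜ_ : ℕ → ℕ × ℕ → Set
x ∉ᶜ (p , q) = x ≢ p × x ≢ q

infix 4 _∉ᶜ_ _#_

_#_ : ℕ × ℕ → ℕ × ℕ → Set
(p , q) # c = p ∉ᶜ c × q ∉ᶜ c

length-setCycles : ∀ π cs → length (foldl setCycle π cs) ≡ length π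
length-setCycles π []             = refl
length-setCycles π ((p , q) ∷ cs) =
  trans (length-setCycles _ cs) (trans (length-↦ (π [ p ↦ q ]) q p) (length-↦ π p q))

setCycles-fixed : ∀ π {cs x} → All (x ∉ᶜ_) cs → foldl setCycle π cs ! x ≡ π ! x
setCycles-fixed π []                   = refl
setCycles-fixed π ((x≢p , x≢q) ∷ x∉cs) =
  trans (setCycles-fixed _ x∉cs) (trans (!-↦-other (π [ _ ↦ _ ]) x≢q) (!-↦-other π x≢p))

-- Earlier cycles matter only through the length of the list, which they preserve, since the cycle
-- itself overwrites both cells. Later cycles miss both cells by disjointness.
setCycles-swaps : ∀ π {cs p q} → AllPairs _#_ cs → (p , q) ∈ cs →
  p ∈ 1⋯ (length π) → q ∈ 1⋯ (length π) →
  foldl setCycle π cs ! p ≡ q × foldl setCycle π cs ! q ≡ p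
setCycles-swaps π {_ ∷ cs} {p} {q} (#s ∷ _) (here refl) p∈ q∈ =
    trans (setCycles-fixed _ (All.map proj₁ #s)) at-p
  , trans (setCycles-fixed _ (All.map proj₂ #s)) at-q
  where
  at-q : (π [ p ↦ q ]) [ q ↦ p ] ! q ≡ p
  at-q = !-↦-same (π [ p ↦ q ]) (subst (λ l → q ∈ 1⋯ l) (sym (length-↦ π p q)) q∈)
  at-p : (π [ p ↦ q ]) [ q ↦ p ] ! p ≡ q
  -- `AllPairs _#_` separates different cycles only; the two entries of one cycle may coincide, and
  -- then the second assignment decides.
  at-p with p ≟ q
  ... | yes refl = at-q
  ... | no p≢q   = trans (!-↦-other (π [ p ↦ q ]) p≢q) (!-↦-same π p∈)
setCycles-swaps π {(p′ , q′) ∷ cs} {p} {q} (_ ∷ #s) (there c∈cs) p∈ q∈ =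
  setCycles-swaps _ #s c∈cs (subst (λ l → p ∈ 1⋯ l) (sym len) p∈) (subst (λ l → q ∈ 1⋯ l) (sym len) q∈)
  where len = trans (length-↦ (π [ p′ ↦ q′ ]) q′ p′) (length-↦ π p′ q′)

-- For given y a pair (x , y) can pass only with x = π ! y, and this pair does pass once y ≤ π ! y,
-- by involutivity. The search over pairs thus collapses to the one-pass test that the RAM program
-- performs, so the lemma serves the decoder and the program alike.
decreasingCycles-involution : ∀ π → (let l = length π) →
  (∀ {y} → y ∈ 1⋯ l → π ! y ∈ 1⋯ l × π ! (π ! y) ≡ y) →
  decreasingCycles π ≡ map (λ y → π ! y , y) (filter (λ y → y ≤? π ! y) (reverse (1⋯ l)))
decreasingCycles-involution π inv = go (reverse (1⋯ l)) (All.tabulate λ y∈ → ∈-resp-↭ (↭-reverse (1⋯ l)) y∈)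
  where
  l = length π
  go : ∀ ys → All (_∈ 1⋯ l) ys →
    filter (isCycle? π) (concatMap (λ y → map (_, y) (1⋯ l)) ys) ≡
    map (λ y → π ! y , y) (filter (λ y → y ≤? π ! y) ys)
  go []       []        = refl
  go (y ∷ ys) (y∈ ∷ ∈s) = trans (filter-++ (isCycle? π) (map (_, y) (1⋯ l)) _)
    (trans (cong₂ _++_ (filter-map-comm (isCycle? π) (_, y) (1⋯ l)) (go ys ∈s)) head)
    where
    rest = map (λ y → π ! y , y) (filter (λ y → y ≤? π ! y) ys)
    head : map (_, y) (filter (isCycle? π ∘ (_, y)) (1⋯ l)) ++ rest ≡
           map (λ y → π ! y , y) (filter (λ y → y ≤? π ! y) (y ∷ ys))
    head with y ≤? π ! y
    ... | yes y≤ = trans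
      (cong (λ zs → map (_, y) zs ++ rest)
        (filter-singleton (isCycle? π ∘ (_, y)) (1⋯-unique l) (proj₁ (inv y∈))
          (y≤ , proj₂ (inv y∈) , refl) (λ _ (_ , _ , eq) → sym eq)))
      (sym (cong (map (λ y → π ! y , y)) (filter-accept (λ y → y ≤? π ! y) y≤)))
    ... | no y≰ = trans
      (cong (λ zs → map (_, y) zs ++ rest)
        (filter-none (isCycle? π ∘ (_, y)) {1⋯ l} (All.tabulate λ { _ (y≤x , _ , refl) → y≰ y≤x })))
      (sym (cong (map (λ y → π ! y , y)) (filter-reject (λ y → y ≤? π ! y) y≰)))

-- Since the last n entries of πᵇ = F ‖ (e) ‖ (n,…,1) are known, Step 5
-- pairs Fᵢ with i, and e is left as the fixed point.
module Pairing (F : List ℕ) (e : ℕ)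
  (perm : F ∷ʳ e ↭ applyUpTo (λ j → suc (length F + j)) (suc (length F))) where

  n = length F

  πᵇ π : List ℕ
  πᵇ = F ++ e ∷ reverse (1⋯ n)
  π  = foldl setCycle (1⋯ (2 * n + 1)) (2-cycles n πᵇ)

  2n+1≡ : 2 * n + 1 ≡ n + suc n
  2n+1≡ = eq n
    where
    eq : ∀ n → 2 * n + 1 ≡ n + suc n
    eq = solve-∀

  upper : List ℕ
  upper = applyUpTo (λ j → suc (n + j)) (suc n)

  1⋯-split : 1⋯ (2 * n + 1) ≡ 1⋯ n ++ upper
  1⋯-split = trans (cong 1⋯ 2n+1≡) (applyUpTo-++ suc n (suc n))

  upper⇒range : x ∈ upper → x ∈ 1⋯ (2 * n + 1)
  upper⇒range {x} x∈ = subst (x ∈_) (sym 1⋯-split) (∈-++⁺ʳ (1⋯ n) x∈)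

  lower⇒range : ∀ {i} → i < n → suc i ∈ 1⋯ (2 * n + 1)
  lower⇒range {i} i<n = subst (suc i ∈_) (sym 1⋯-split) (∈-++⁺ˡ (∈-applyUpTo⁺ suc i<n))

  upper⇒> : x ∈ upper → n < x
  upper⇒> x∈ with j , _ , refl ← ∈-applyUpTo⁻ (λ j → suc (n + j)) x∈ = s≤s (m≤m+n n j)

  unique : Unique (F ∷ʳ e)
  unique = Unique-resp-↭ (↭-sym perm) (Unique.applyUpTo⁺₁ _ (suc n) λ i<j _ → <⇒≢ (s<s (+-monoʳ-< n i<j)))

  e∈upper : e ∈ upper
  e∈upper = ∈-resp-↭ perm (∈-++⁺ʳ F (here refl))

  F∈upper : ∀ {i} → i < n → F ! suc i ∈ upper
  F∈upper i<n = ∈-resp-↭ perm (∈-++⁺ˡ (!-∈ F i<n))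

  F≢lower : ∀ {i j} → i < n → j < n → F ! suc i ≢ suc j
  F≢lower i<n j<n eq = <⇒≱ (upper⇒> (F∈upper i<n)) (subst (_≤ n) (sym eq) j<n)

  e≢F : ∀ {i} → i < n → e ≢ F ! suc i
  e≢F i<n refl = Unique-++⇒disjoint F unique (!-∈ F i<n) (here refl)

  -- With n = i + 1 + d the index equals n + d + 2, which skips `F` and `e` and lands on entry d + 1
  -- of (n,...,1), namely n - d.
  mirror : ∀ {i} → i < n → πᵇ ! (2 * n + 1 ∸ suc i + 1) ≡ suc i
  mirror {i} i<n with d , 1+i+d≡n ← m≤n⇒∃[o]m+o≡n i<n = begin
    πᵇ ! (2 * n + 1 ∸ suc i + 1)             ≡⟨ cong (πᵇ !_) index ⟩
    πᵇ ! (n + suc (suc d))                   ≡⟨ !-++ʳ F (e ∷ reverse (1⋯ n)) (suc d) ⟩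
    reverse (1⋯ n) ! suc d                   ≡⟨ cong (λ xs → xs ! suc d) (reverse-applyUpTo suc n) ⟩
    applyDownFrom suc n ! suc d              ≡⟨ cong (λ m → applyDownFrom suc m ! suc d) n≡ ⟩
    applyDownFrom suc (suc (d + i)) ! suc d  ≡⟨ !-applyDownFrom suc d i ⟩
    suc i                                    ∎
    where
    open ≡-Reasoning
    n≡ : n ≡ suc (d + i)
    n≡ = trans (sym 1+i+d≡n) (cong suc (+-comm i d))
    eq : ∀ i d n → n + suc (suc (i + d)) ≡ suc i + (n + suc d)
    eq = solve-∀
    eq′ : ∀ n d → n + suc d + 1 ≡ n + suc (suc d)
    eq′ = solve-∀
    index : 2 * n + 1 ∸ suc i + 1 ≡ n + suc (suc d)
    index = trans (cong (λ m → m ∸ suc i + 1) (trans 2n+1≡ (trans (cong (λ m → n + suc m) (sym 1+i+d≡n)) (eq i d n))))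
                  (trans (cong (_+ 1) (m+n∸m≡n (suc i) (n + suc d))) (eq′ n d))

  cycles : List (ℕ × ℕ)
  cycles = map (λ i → F ! i , i) (1⋯ n)

  2-cycles≡ : 2-cycles n πᵇ ≡ cycles
  2-cycles≡ = map-cong-local (All.applyUpTo⁺₁ suc n λ i<n →
    cong₂ _,_ (!-++ˡ F _ i<n) (mirror i<n))

  π≡ : π ≡ foldl setCycle (1⋯ (2 * n + 1)) cycles
  π≡ = cong (foldl setCycle (1⋯ (2 * n + 1))) 2-cycles≡

  length-π : length π ≡ 2 * n + 1
  length-π = trans (length-setCycles (1⋯ (2 * n + 1)) (2-cycles n πᵇ)) (length-applyUpTo suc (2 * n + 1))

  cycles-disjoint : AllPairs _#_ cycles
  cycles-disjoint = AllPairs.map⁺ (AllPairs.applyUpTo⁺₁ suc n λ i<j j<n → let i<n = <-trans i<j j<n in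
    ((<⇒≢ i<j ∘ !-injective F (Unique-++⁻ˡ F unique) i<n j<n) , F≢lower i<n j<n) ,
    (F≢lower j<n i<n ∘ sym) , <⇒≢ (s<s i<j))

  swaps : ∀ {i} → i < n → π ! (F ! suc i) ≡ suc i × π ! suc i ≡ F ! suc i
  swaps {i} i<n rewrite π≡ = setCycles-swaps (1⋯ (2 * n + 1)) cycles-disjoint
    (∈-map⁺ (λ i → F ! i , i) (∈-applyUpTo⁺ suc i<n))
    (resize (upper⇒range (F∈upper i<n))) (resize (lower⇒range i<n))
    where
    resize : ∀ {x} → x ∈ 1⋯ (2 * n + 1) → x ∈ 1⋯ (length (1⋯ (2 * n + 1)))
    resize {x} = subst (λ l → x ∈ 1⋯ l) (sym (length-applyUpTo suc (2 * n + 1)))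

  fixes-e : π ! e ≡ e
  fixes-e rewrite π≡ = trans
    (setCycles-fixed (1⋯ (2 * n + 1)) (All.map⁺ (All.applyUpTo⁺₁ suc n λ i<n →
      e≢F i<n , λ eq → <⇒≱ (upper⇒> e∈upper) (subst (_≤ n) (sym eq) i<n))))
    identity
    where
    identity : 1⋯ (2 * n + 1) ! e ≡ e
    identity with j , j< , eq ← ∈-applyUpTo⁻ suc (upper⇒range e∈upper) rewrite eq = !-applyUpTo suc j<

  -- The three ways in which `π` acts on its range: a number up to n goes up to its entry of `F`, an
  -- entry of `F` goes down to its index, and `e` stays.
  data Class : ℕ → Set where
    low   : ∀ {i} → i < n → Class (suc i)
    high  : ∀ {i} → i < n → Class (F ! suc i)
    fixed : Class e

  classify-upper : y ∈ upper → Class y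
  classify-upper y∈ with ∈-++⁻ F (∈-resp-↭ (↭-sym perm) y∈)
  ... | inj₁ y∈F with i , i< , refl ← ∈-! F y∈F = high i<
  ... | inj₂ (here refl) = fixed

  classify : y ∈ 1⋯ (2 * n + 1) → Class y
  classify {y} y∈ with ∈-++⁻ (1⋯ n) (subst (y ∈_) 1⋯-split y∈)
  ... | inj₁ y∈low with i , i< , refl ← ∈-applyUpTo⁻ suc y∈low = low i<
  ... | inj₂ y∈up  = classify-upper y∈up

  involution : y ∈ 1⋯ (length π) → π ! y ∈ 1⋯ (length π) × π ! (π ! y) ≡ y
  involution y∈ rewrite length-π with classify y∈
  ... | low  {i} i<n rewrite proj₂ (swaps i<n) = upper⇒range (F∈upper i<n) , proj₁ (swaps i<n)
  ... | high {i} i<n rewrite proj₁ (swaps i<n) = lower⇒range i<n , proj₂ (swaps i<n)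
  ... | fixed rewrite fixes-e = upper⇒range e∈upper , fixes-e

  smaller-entries : filter (λ y → y ≤? π ! y) (reverse (1⋯ (length π))) ≡ e ∷ reverse (1⋯ n)
  smaller-entries = begin
    filter P? (reverse (1⋯ (length π)))                ≡⟨ cong (λ l → filter P? (reverse (1⋯ l))) length-π ⟩
    filter P? (reverse (1⋯ (2 * n + 1)))               ≡⟨ filter-reverse P? (1⋯ (2 * n + 1)) ⟩
    reverse (filter P? (1⋯ (2 * n + 1)))               ≡⟨ cong (reverse ∘ filter P?) 1⋯-split ⟩
    reverse (filter P? (1⋯ n ++ upper))                ≡⟨ cong reverse (filter-++ P? (1⋯ n) upper) ⟩
    reverse (filter P? (1⋯ n) ++ filter P? upper)      ≡⟨ cong₂ (λ xs ys → reverse (xs ++ ys)) lows ups ⟩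
    reverse (1⋯ n ++ [ e ])                            ≡⟨ reverse-++ (1⋯ n) [ e ] ⟩
    e ∷ reverse (1⋯ n)                                 ∎
    where
    open ≡-Reasoning
    P? : ∀ y → Dec (y ≤ π ! y)
    P? = λ y → y ≤? π ! y
    lows : filter P? (1⋯ n) ≡ 1⋯ n
    lows = filter-all P? (All.applyUpTo⁺₁ suc n λ i<n →
      subst (_ ≤_) (sym (proj₂ (swaps i<n))) (<⇒≤ (≤-<-trans i<n (upper⇒> (F∈upper i<n)))))
    only-e : y ∈ upper → y ≤ π ! y → y ≡ e
    only-e y∈ y≤ with upper⇒> y∈ | classify-upper y∈
    ... | n<y | low i<n  = contradiction i<n (<⇒≱ n<y)
    ... | n<y | high i<n = contradiction (subst (_ ≤_) (proj₁ (swaps i<n)) y≤) (<⇒≱ (≤-<-trans i<n n<y))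
    ... | _   | fixed    = refl
    ups : filter P? upper ≡ [ e ]
    ups = filter-singleton P? (Unique-resp-↭ perm unique) e∈upper (≤-reflexive (sym fixes-e)) only-e

  decreasingCycles≡ : decreasingCycles π ≡ map (λ y → π ! y , y) (e ∷ reverse (1⋯ n))
  decreasingCycles≡ = trans (decreasingCycles-involution π involution)
                            (cong (map (λ y → π ! y , y)) smaller-entries)

  -- After the fixed point is dropped, the larger entries are read in the order π n,...,π 1, which
  -- is `F` backwards; the reversal in `unfoldCycles` restores it. The smaller entries already stand
  -- as e, n,...,1.
  unfoldCycles≡ : unfoldCycles (decreasingCycles π) ≡ πᵇ
  unfoldCycles≡ rewrite decreasingCycles≡ = cong₂ _++_ as bs
    where
    open ≡-Reasoning
    g : ℕ → ℕ × ℕ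
    g y = π ! y , y
    R = reverse (1⋯ n)
    ≠? : ∀ (ab : ℕ × ℕ) → Dec (proj₁ ab ≢ proj₂ ab)
    ≠? ab = ¬? (proj₁ ab ≟ proj₂ ab)
    moved : All (λ y → π ! y ≢ y) R
    moved = All-resp-↭ (↭-sym (↭-reverse (1⋯ n))) (All.applyUpTo⁺₁ suc n λ i<n eq →
      F≢lower i<n i<n (trans (sym (proj₂ (swaps i<n))) eq))
    as : reverse (map proj₁ (filter ≠? (map g (e ∷ R)))) ≡ F
    as = begin
      reverse (map proj₁ (filter ≠? (map g (e ∷ R))))
        ≡⟨ cong (reverse ∘ map proj₁) (filter-map-comm ≠? g (e ∷ R)) ⟩
      reverse (map proj₁ (map g (filter (≠? ∘ g) (e ∷ R))))
        ≡⟨ cong (reverse ∘ map proj₁ ∘ map g)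
             (trans (filter-reject (≠? ∘ g) (λ e≢e → e≢e fixes-e)) (filter-all (≠? ∘ g) moved)) ⟩
      reverse (map proj₁ (map g R))    ≡⟨ cong reverse (map-∘ R) ⟨
      reverse (map (π !_) R)           ≡⟨ reverse-map (π !_) R ⟨
      map (π !_) (reverse R)           ≡⟨ cong (map (π !_)) (reverse-involutive (1⋯ n)) ⟩
      map (π !_) (1⋯ n)                ≡⟨ map-cong-local (All.applyUpTo⁺₁ suc n (proj₂ ∘ swaps)) ⟩
      map (F !_) (1⋯ n)                ≡⟨ map-! F ⟩
      F                                ∎
    bs : map proj₂ (map g (e ∷ R)) ≡ e ∷ R
    bs = trans (sym (map-∘ (e ∷ R))) (map-id (e ∷ R))

-- Positions of the bits

-- positions, with f i instead of i + 1 as the name of the i-th place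
positionsBy : (ℕ → ℕ) → Bit → List Bit → List ℕ
positionsBy f d ds = map proj₁ (filter (λ pd → proj₂ pd Fin.≟ d) (zip (applyUpTo f (length ds)) ds))

positionsBy-++ : ∀ f d ds es →
  positionsBy f d (ds ++ es) ≡ positionsBy f d ds ++ positionsBy (f ∘ (length ds +_)) d es
positionsBy-++ f d []        es = refl
positionsBy-++ f d (d′ ∷ ds) es with does (d′ Fin.≟ d)
... | true  = cong (f 0 ∷_) (positionsBy-++ (f ∘ suc) d ds es)
... | false = positionsBy-++ (f ∘ suc) d ds es

positionsBy-↭ : ∀ f ds → positionsBy f 1b ds ++ positionsBy f 0b ds ↭ applyUpTo f (length ds)
positionsBy-↭ f []              = ↭-refl
positionsBy-↭ f (suc zero ∷ ds) = prep (f 0) (positionsBy-↭ (f ∘ suc) ds)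
positionsBy-↭ f (zero ∷ ds)     = ↭-trans
  (shift (f 0) (positionsBy (f ∘ suc) 1b ds) (positionsBy (f ∘ suc) 0b ds))
  (prep (f 0) (positionsBy-↭ (f ∘ suc) ds))

positionsBy-1-zeros : ∀ f n → positionsBy f 1b (replicate n 0b) ≡ []
positionsBy-1-zeros f zero    = refl
positionsBy-1-zeros f (suc n) = positionsBy-1-zeros (f ∘ suc) n

positionsBy-0-zeros : ∀ f n → positionsBy f 0b (replicate n 0b) ≡ applyUpTo f n
positionsBy-0-zeros f zero    = refl
positionsBy-0-zeros f (suc n) = cong (f 0 ∷_) (positionsBy-0-zeros (f ∘ suc) n)

-- Any χ will do that is right on the two lists of positions, because between them they name every
-- place. The decoder's membership test is such a χ.
bits-from-positions : ∀ f ds (χ : ℕ → Bit) →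
  (∀ {p} → p ∈ positionsBy f 1b ds → χ p ≡ 1b) → (∀ {p} → p ∈ positionsBy f 0b ds → χ p ≡ 0b) →
  map χ (applyUpTo f (length ds)) ≡ ds
bits-from-positions f []              χ ones zeros = refl
bits-from-positions f (suc zero ∷ ds) χ ones zeros =
  cong₂ _∷_ (ones (here refl)) (bits-from-positions (f ∘ suc) ds χ (ones ∘ there) zeros)
bits-from-positions f (zero ∷ ds)     χ ones zeros =
  cong₂ _∷_ (zeros (here refl)) (bits-from-positions (f ∘ suc) ds χ ones (zeros ∘ there))

-- The padded bit string, its bitonic sequence, and decoding on bit strings.

padded : List Bit → List Bit
padded B = replicate (length B) 0b ++ B ++ [ 0b ]

module Padded (B : List Bit) where

  n = length B

  place : ℕ → ℕ
  place j = suc (n + j)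

  -- The number 2n + 1: the place of the appended 0 and also the largest place.
  M : ℕ
  M = place n

  X Z R : List ℕ
  X = positionsBy place 1b (B ++ [ 0b ])
  Z = positionsBy place 0b (B ++ [ 0b ])
  R = reverse (positionsBy place 0b B) ++ reverse (1⋯ n)

  ones : positions 1b (padded B) ≡ X
  ones rewrite positionsBy-++ suc 1b (replicate n 0b) (B ++ [ 0b ])
             | positionsBy-1-zeros suc n | length-replicate n {0b} = refl

  zeros : positions 0b (padded B) ≡ 1⋯ n ++ Z
  zeros rewrite positionsBy-++ suc 0b (replicate n 0b) (B ++ [ 0b ])
              | positionsBy-0-zeros suc n | length-replicate n {0b} = refl

  reverse-Z : reverse Z ≡ M ∷ reverse (positionsBy place 0b B)
  reverse-Z = trans
    (cong reverse (trans (positionsBy-++ place 0b B [ 0b ])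
                         (cong (λ k → positionsBy place 0b B ++ [ place k ]) (+-identityʳ n))))
    (reverse-++ (positionsBy place 0b B) [ M ])

  -- The cut seen by the encoder, with the n + 1 upper places in front. `bitonic≡` is the cut seen
  -- by the decoder, at the maximum `M`.
  bitonic≡U : bitonic (padded B) ≡ (X ++ reverse Z) ++ reverse (1⋯ n)
  bitonic≡U = trans (cong₂ (λ xs ys → xs ++ reverse ys) ones zeros)
    (trans (cong (X ++_) (reverse-++ (1⋯ n) Z)) (sym (++-assoc X (reverse Z) (reverse (1⋯ n)))))

  bitonic≡ : bitonic (padded B) ≡ X ++ M ∷ R
  bitonic≡ = trans bitonic≡U (trans (++-assoc X (reverse Z) (reverse (1⋯ n)))
    (cong (λ ys → X ++ ys ++ reverse (1⋯ n)) reverse-Z))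

  length-tail : length (B ++ [ 0b ]) ≡ suc n
  length-tail = trans (length-++ B) (+-comm n 1)

  U-perm : X ++ reverse Z ↭ applyUpTo place (suc n)
  U-perm = subst (λ k → X ++ reverse Z ↭ applyUpTo place k) length-tail
    (↭-trans (++⁺ˡ X (↭-reverse Z)) (positionsBy-↭ place (B ++ [ 0b ])))

  length-padded : length (padded B) ≡ M
  length-padded = trans (length-++ (replicate n 0b))
    (trans (cong₂ _+_ (length-replicate n) length-tail) (+-suc n n))

  bitonic-perm : bitonic (padded B) ↭ 1⋯ M
  bitonic-perm = ↭-trans (++⁺ˡ (positions 1b (padded B)) (↭-reverse (positions 0b (padded B))))
    (subst (λ k → positions 1b (padded B) ++ positions 0b (padded B) ↭ 1⋯ k) length-padded
      (positionsBy-↭ suc (padded B)))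

  bitonic-unique : Unique (X ++ M ∷ R)
  bitonic-unique = subst Unique bitonic≡ (Unique-resp-↭ (↭-sym bitonic-perm) (1⋯-unique M))

  bitonic≤M : All (_≤ M) (X ++ M ∷ R)
  bitonic≤M = subst (All (_≤ M)) bitonic≡
    (All-resp-↭ (↭-sym bitonic-perm) (All.tabulate (proj₂ ∘ ∈-1⋯⁻)))

  X<M : All (_< M) X
  X<M = All.tabulate λ x∈X → ≤∧≢⇒< (All.lookup (All.++⁻ˡ X bitonic≤M) x∈X)
    λ { refl → Unique-++⇒disjoint X bitonic-unique x∈X (here refl) }

  R<M : All (_< M) R
  R<M with All.++⁻ʳ X bitonic≤M | Unique-++⁻ʳ X bitonic-unique
  ... | _ ∷ R≤M | M≢ ∷ _ = All.tabulate λ x∈R →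
    ≤∧≢⇒< (All.lookup R≤M x∈R) (λ { refl → All.lookup M≢ x∈R refl })

  X-disjoint : x ∈ X → x ∉ M ∷ R
  X-disjoint = Unique-++⇒disjoint X bitonic-unique

  π : List ℕ
  π = encodeBits B

  -- Stated about `π` alone, so that the `F` and `e` obtained by cutting off the last entry of
  -- `X ++ reverse Z` stay local to `facts`.
  record Facts : Set where
    field
      length-π            : length π ≡ 2 * n + 1
      involution          : y ∈ 1⋯ (length π) → π ! y ∈ 1⋯ (length π) × π ! (π ! y) ≡ y
      unfoldCycles≡       : unfoldCycles (decreasingCycles π) ≡ bitonic (padded B)
      length-cycles       : length (decreasingCycles π) ≡ suc n

  facts : Facts
  facts with X ++ reverse Z in U≡ | initLast (X ++ reverse Z)
  ... | .[] | [] = contradiction (↭-length (subst (_↭ applyUpTo place (suc n)) U≡ U-perm)) λ ()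
  ... | .(F ∷ʳ e) | F ∷ʳ′ e = from-pairing |F|≡n
    where
    perm : F ∷ʳ e ↭ applyUpTo place (suc n)
    perm = subst (_↭ applyUpTo place (suc n)) U≡ U-perm
    |F|≡n : length F ≡ n
    |F|≡n = suc-injective (trans (+-comm 1 (length F)) (trans (sym (length-++ F))
      (trans (↭-length perm) (length-applyUpTo place (suc n)))))
    from-pairing : length F ≡ n → Facts
    from-pairing eq = record
      { length-π      = trans (cong length π≡) (trans P.length-π (cong (λ m → 2 * m + 1) eq))
      ; involution    = subst (λ ρ → ∀ {y} → y ∈ 1⋯ (length ρ) → ρ ! y ∈ 1⋯ (length ρ) × ρ ! (ρ ! y) ≡ y)
                              (sym π≡) P.involution
      ; unfoldCycles≡ = trans (cong (unfoldCycles ∘ decreasingCycles) π≡) (trans P.unfoldCycles≡ πᵇ≡)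
      ; length-cycles = trans (cong (length ∘ decreasingCycles) π≡) (trans (cong length P.decreasingCycles≡)
          (trans (length-map _ (e ∷ reverse (1⋯ (length F))))
            (cong suc (trans (length-reverse (1⋯ (length F))) (trans (length-applyUpTo suc (length F)) eq)))))
      }
      where
      module P = Pairing F e (subst (λ m → F ∷ʳ e ↭ applyUpTo (λ j → suc (m + j)) (suc m)) (sym eq) perm)
      πᵇ≡ : P.πᵇ ≡ bitonic (padded B)
      πᵇ≡ = trans (cong (λ m → F ++ e ∷ reverse (1⋯ m)) eq) (trans (sym (++-assoc F [ e ] (reverse (1⋯ n))))
        (sym (trans bitonic≡U (cong (_++ reverse (1⋯ n)) U≡))))
      π≡ : π ≡ P.π
      π≡ = cong₂ (λ m xs → foldl setCycle (1⋯ (2 * m + 1)) (2-cycles m xs)) (sym eq) (sym πᵇ≡)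

  open Facts facts public

  max≡M : max 0 (X ++ M ∷ R) ≡ M
  max≡M = max≈v⁺ (∈-++⁺ʳ X (here refl)) bitonic≤M z≤n

  beforeMax≡ : beforeMax (unfoldCycles (decreasingCycles π)) ≡ X
  beforeMax≡ rewrite unfoldCycles≡ | bitonic≡ | max≡M =
    takeWhile-++-∷ (λ x → ¬? (x ≟ M)) (All.map <⇒≢ X<M) (λ M≢M → M≢M refl)

  length-π≡M : length π ≡ M
  length-π≡M = trans length-π (eq n)
    where
    eq : ∀ n → 2 * n + 1 ≡ suc (n + n)
    eq = solve-∀

  half-length : ⌊ length π /2⌋ ≡ n
  -- By definition `⌈_/2⌉` of n + n is `⌊_/2⌋` of its successor `M`.
  half-length = trans (cong ⌊_/2⌋ length-π≡M) (sym (n≡⌈n+n/2⌉ n))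

  zeros-in-Y : ∀ {p} → p ∈ positions 0b (padded B) → p ∈ M ∷ R
  zeros-in-Y {p} p∈ = subst (p ∈_)
    -- Two factorisations of the bitonic sequence begin with `X`; cancelling it identifies the
    -- reversed positions of the 0s with `M ∷ R`.
    (++-cancelˡ X _ _ (trans (cong (_++ reverse (positions 0b (padded B))) (sym ones)) bitonic≡))
    (∈-resp-↭ (↭-sym (↭-reverse (positions 0b (padded B)))) p∈)

  indicator≡ : indicator (length π) (beforeMax (unfoldCycles (decreasingCycles π))) ≡ padded B
  indicator≡ = trans (cong₂ indicator (trans length-π≡M (sym length-padded)) beforeMax≡)
    (bits-from-positions suc (padded B) (λ p → if does (_∈?_ _≟_ p X) then 1b else 0b)
      (λ {p} p∈ → cong (if_then 1b else 0b) (dec-true (_∈?_ _≟_ p X) (subst (p ∈_) ones p∈)))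
      (λ {p} p∈ → cong (if_then 1b else 0b) (dec-false (_∈?_ _≟_ p X) λ p∈X →
        X-disjoint p∈X (zeros-in-Y p∈))))

  decodeBits≡ : decodeBits π ≡ B
  decodeBits≡ rewrite half-length | indicator≡ =
    take-drop-middle (replicate n 0b) B [ 0b ] (length-replicate n) refl

-- Binary numbers

-- `fromDigits` reads the least significant digit first, so the appended 0 is a leading zero.
fromDigits-∷ʳ-0b : ∀ (ds : List Bit) → fromDigits (ds ∷ʳ 0b) ≡ fromDigits ds
fromDigits-∷ʳ-0b []       = refl
fromDigits-∷ʳ-0b (d ∷ ds) = cong (λ v → toℕ d + v * 2) (fromDigits-∷ʳ-0b ds)

value-dropWhile-0b : ∀ ds → value (dropWhile (Fin._≟ 0b) ds) ≡ value ds
value-dropWhile-0b []              = refl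
value-dropWhile-0b (suc zero ∷ ds) = refl
value-dropWhile-0b (zero ∷ ds)     = trans (value-dropWhile-0b ds)
  (sym (trans (cong fromDigits (unfold-reverse 0b ds)) (fromDigits-∷ʳ-0b (reverse ds))))

value-binary : ∀ w → value (binary w) ≡ w
value-binary w with ds , ds≡w ← toDigits 2 w =
  trans (value-dropWhile-0b (reverse ds)) (trans (cong fromDigits (reverse-involutive ds)) ds≡w)

-- Linear resource bounds

updateAt-all : ∀ {A : Set} {P : A → Set} {n} (xs : Vector A n) i {f} →
  P (f (xs i)) → (∀ j → P (xs j)) → ∀ j → P (updateAt xs i f j)
updateAt-all {n = suc n} xs zero    pf ps zero    = pf
updateAt-all {n = suc n} xs zero    pf ps (suc j) = ps (suc j)
updateAt-all {n = suc n} xs (suc i) pf ps zero    = ps zero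
updateAt-all {P = P} {n = suc n} xs (suc i) pf ps (suc j) = updateAt-all {P = P} (xs ∘ suc) i pf (ps ∘ suc) j

<∸⇒+< : ∀ m n {i} → i < n ∸ m → m + i < n
<∸⇒+< zero    n       i<n = i<n
<∸⇒+< (suc m) (suc n) i<  = s<s (<∸⇒+< m n i<)

-- A single v bounds both indices and values, since array indices are themselves computed values.
record Within (t v : ℕ) (κ : Cost) : Set where
  constructor within
  field
    time≤   : time κ ≤ t
    extent≤ : extent κ ≤ v
    size≤   : size κ ≤ v

⊕-within : ∀ {t t′ v κ κ′} → Within t v κ → Within t′ v κ′ → Within (t + t′) v (κ ⊕ κ′)
⊕-within (within t≤ e≤ s≤) (within t≤′ e≤′ s≤′) =
  within (+-mono-≤ t≤ t≤′) (⊔-lub e≤ e≤′) (⊔-lub s≤ s≤′)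

within-mono : ∀ {t t′ v v′ κ} → t ≤ t′ → v ≤ v′ → Within t v κ → Within t′ v′ κ
within-mono t≤t′ v≤v′ (within t≤ e≤ s≤) = within (≤-trans t≤ t≤t′) (≤-trans e≤ v≤v′) (≤-trans s≤ v≤v′)

op-within : ∀ {v u} → u ≤ v → Within 1 v (op u)
op-within u≤v = within ≤-refl z≤n u≤v

access-within : ∀ {v k u} → k ≤ v → u ≤ v → Within 1 v (access k u)
access-within k≤v u≤v = within ≤-refl k≤v u≤v

module Growth {#scalars #arrays : ℕ} where
  open RAM #scalars #arrays

  -- All cells are included, also those never written, so that a read is bounded whatever its index.
  Bounded : ℕ → State → Set
  Bounded V σ = (∀ x → scalar σ x ≤ V) × (∀ a k → cell σ a k ≤ V)

  bounded-mono : ∀ {V V′ σ} → V ≤ V′ → Bounded V σ → Bounded V′ σ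
  bounded-mono V≤V′ (s≤ , c≤) = (λ x → ≤-trans (s≤ x) V≤V′) , (λ a k → ≤-trans (c≤ a k) V≤V′)

  setScalar-bounded : ∀ {V σ} x {v} → v ≤ V → Bounded V σ → Bounded V (setScalar x v σ)
  setScalar-bounded {V} {σ} x v≤V (s≤ , c≤) = updateAt-all {P = _≤ V} (scalar σ) x v≤V s≤ , c≤

  setCell-bounded : ∀ {V σ} a k {v} → v ≤ V → Bounded V σ → Bounded V (setCell a k v σ)
  setCell-bounded {V} {σ} a k {v} v≤V (s≤ , c≤) =
    s≤ , updateAt-all {P = λ f → ∀ j → f j ≤ V} (cell σ) a updated c≤
    where
    updated : ∀ j → (if j ≡ᵇ k then v else cell σ a j) ≤ V
    updated j with j ≡ᵇ k
    ... | true  = v≤V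
    ... | false = c≤ a j

  -- One constant, independent of V and of the state, bounds both the time and the amount by which
  -- values may exceed V.
  record SlowExpr (e : Expr) : Set where
    constructor slow
    field
      rate  : ℕ
      bound : ∀ {V σ} → Bounded V σ → ⟦ e ⟧ σ ≤ rate + V × Within rate (rate + V) (costᵉ e σ)

  record SlowTest (t : Test) : Set where
    constructor slow
    field
      rate  : ℕ
      bound : ∀ {V σ} → Bounded V σ → Within rate (rate + V) (costᵗ t σ)

  record Slow (c : Cmd) : Set where
    constructor slow
    field
      rate  : ℕ
      bound : ∀ {V σ} → Bounded V σ → Bounded (rate + V) (exec c σ) × Within rate (rate + V) (cost c σ)

  -- The factor is positive so that the bound 1 ≤ V is passed on to the
  -- next command.
  record Linear (c : Cmd) : Set where
    constructor linear
    field
      factor : ℕ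
      bound  : ∀ {V σ} → 1 ≤ V → Bounded V σ →
        Bounded (suc factor * V) (exec c σ) × Within (suc factor * V) (suc factor * V) (cost c σ)

  private
    left : ∀ g h {V} → g + V ≤ g + h + V
    left g h {V} = +-monoˡ-≤ V (m≤m+n g h)

    right : ∀ g h {V} → h + V ≤ g + h + V
    right g h {V} = +-monoˡ-≤ V (m≤n+m h g)

  slow-lit : ∀ k → SlowExpr (lit k)
  -- The successor pays for the one operation even when k is 0.
  slow-lit k = slow (suc k) λ {V} _ → let k≤ = m≤n⇒m≤1+n (m≤m+n k V) in
    k≤ , within-mono (s≤s z≤n) ≤-refl (op-within k≤)

  slow-var : ∀ x → SlowExpr (var x)
  slow-var x = slow 1 λ (s≤ , _) → m≤n⇒m≤1+n (s≤ x) , op-within (m≤n⇒m≤1+n (s≤ x))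

  slow-cell : ∀ a {e} → SlowExpr e → SlowExpr (a ⟨ e ⟩)
  slow-cell a {e} (slow g se) = slow (g + 1) λ {V} {σ} bnd →
    let v≤ , w = se bnd
        c≤ = ≤-trans (proj₂ bnd a (⟦ e ⟧ σ)) (m≤n+m V (g + 1))
    in c≤ , ⊕-within (within-mono ≤-refl (left g 1) w) (access-within (≤-trans v≤ (left g 1)) c≤)

  -- The second operand is a literal because a sum of two arbitrary values could reach 2V, which is
  -- not additive growth. The 2 pays for reading the literal and adding, and k covers the growth.
  slow-⊞ : ∀ {e} → SlowExpr e → ∀ k → SlowExpr (e ⊞ lit k)
  slow-⊞ {e} (slow g se) k = slow (g + (2 + k)) λ {V} {σ} bnd →
    let v≤ , w = se bnd
        sum≤ : ⟦ e ⟧ σ + k ≤ g + (2 + k) + V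
        sum≤ = ≤-trans (+-mono-≤ v≤ (m≤n+m k 2)) (≤-reflexive (eq g V k))
        k≤ : k ≤ g + (2 + k) + V
        k≤ = ≤-trans (m≤n+m k (⟦ e ⟧ σ)) sum≤
    in sum≤ , within-mono (+-monoʳ-≤ g (m≤m+n 2 k)) ≤-refl
         (⊕-within (within-mono ≤-refl (left g (2 + k)) w) (⊕-within (op-within k≤) (op-within sum≤)))
    where
    eq : ∀ g V k → g + V + (2 + k) ≡ g + (2 + k) + V
    eq = solve-∀

  private
    -- κ stands for the single operation that consumes both operands: a subtraction, a comparison or
    -- a store. The 1 in the rate pays for it.
    two : ∀ {e f} → SlowExpr e → SlowExpr f → ∃ λ g → ∀ {V σ} → Bounded V σ →
      ⟦ e ⟧ σ ≤ g + V × ⟦ f ⟧ σ ≤ g + V ×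
      (∀ {κ} → Within 1 (g + V) κ → Within g (g + V) (costᵉ e σ ⊕ costᵉ f σ ⊕ κ))
    two (slow g se) (slow h sf) = g + (h + 1) , λ {V} bnd →
      let v≤ , w = se bnd
          v≤′ , w′ = sf bnd
          h≤ : h + V ≤ g + (h + 1) + V
          h≤ = ≤-trans (left h 1) (right g (h + 1))
      in ≤-trans v≤ (left g (h + 1)) , ≤-trans v≤′ h≤ ,
         λ w″ → ⊕-within (within-mono ≤-refl (left g (h + 1)) w) (⊕-within (within-mono ≤-refl h≤ w′) w″)

  slow-⊟ : ∀ {e f} → SlowExpr e → SlowExpr f → SlowExpr (e ⊟ f)
  slow-⊟ {e} {f} se sf with g , both ← two se sf = slow g λ {V} {σ} bnd →
    let v≤ , _ , w = both bnd
        d≤ = ≤-trans (m∸n≤m (⟦ e ⟧ σ) (⟦ f ⟧ σ)) v≤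
    in d≤ , w (op-within d≤)

  private
    slow-comparison : ∀ {e f t} → (∀ {σ} → costᵗ t σ ≡ costᵉ e σ ⊕ costᵉ f σ ⊕ op 0) →
      SlowExpr e → SlowExpr f → SlowTest t
    slow-comparison cost≡ se sf with g , both ← two se sf =
      slow g λ bnd → subst (Within g _) (sym cost≡) (proj₂ (proj₂ (both bnd)) (op-within z≤n))

  slow-≤ : ∀ {e f} → SlowExpr e → SlowExpr f → SlowTest (e ≤ᵗ f)
  slow-≤ = slow-comparison refl

  slow-< : ∀ {e f} → SlowExpr e → SlowExpr f → SlowTest (e <ᵗ f)
  slow-< = slow-comparison refl

  slow-≠ : ∀ {e f} → SlowExpr e → SlowExpr f → SlowTest (e ≠ᵗ f)
  slow-≠ = slow-comparison refl

  slow-≔ : ∀ x {e} → SlowExpr e → Slow (x ≔ e)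
  slow-≔ x {e} (slow g se) = slow (g + 1) λ {V} {σ} bnd →
    let v≤ , w = se bnd
        v≤′ = ≤-trans v≤ (left g 1)
    in setScalar-bounded x v≤′ (bounded-mono (m≤n+m V (g + 1)) bnd)
     , ⊕-within (within-mono ≤-refl (left g 1) w) (op-within v≤′)

  slow-⟨⟩≔ : ∀ a {e f} → SlowExpr e → SlowExpr f → Slow (a ⟨ e ⟩≔ f)
  slow-⟨⟩≔ a {e} {f} se sf with g , both ← two se sf = slow g λ {V} {σ} bnd →
    let k≤ , v≤ , w = both bnd
    in setCell-bounded a (⟦ e ⟧ σ) v≤ (bounded-mono (m≤n+m V g) bnd) , w (access-within k≤ v≤)

  slow-⨾ : ∀ {c d} → Slow c → Slow d → Slow (c ⨾ d)
  slow-⨾ (slow g se) (slow h sf) = slow (g + h) λ {V} bnd →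
    let bnd′ , w = se bnd
        bnd″ , w′ = sf bnd′
        h+ : h + (g + V) ≤ g + h + V
        h+ = ≤-reflexive (eq g h V)
    in bounded-mono h+ bnd″ , ⊕-within (within-mono ≤-refl (left g h) w) (within-mono ≤-refl h+ w′)
    where
    eq : ∀ g h V → h + (g + V) ≡ g + h + V
    eq = solve-∀

  slow-when : ∀ {t c} → SlowTest t → Slow c → Slow (when t then c)
  -- The 1 covers the operation charged when the test fails, so that one rate fits both branches.
  slow-when {t} {c} (slow g se) (slow h sf) = slow (g + (1 + h)) λ {V} {σ} bnd →
    let bnd′ , w = branch V σ bnd
    in bounded-mono (right g (1 + h)) bnd′ ,
       ⊕-within (within-mono ≤-refl (left g (1 + h)) (se bnd)) (within-mono ≤-refl (right g (1 + h)) w)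
    where
    branch : ∀ V σ → Bounded V σ → Bounded (1 + h + V) (exec (when t then c) σ) ×
      Within (1 + h) (1 + h + V) (if holds t σ then cost c σ else op 0)
    branch V σ bnd with holds t σ
    ... | true  = let bnd′ , w = sf bnd in
      bounded-mono (n≤1+n _) bnd′ , within-mono (n≤1+n h) (n≤1+n _) w
    ... | false = bounded-mono (m≤n+m V (1 + h)) bnd , within-mono (m≤m+n 1 h) ≤-refl (op-within z≤n)

  slow⇒linear : ∀ {c} → Slow c → Linear c
  slow⇒linear (slow g se) = linear g λ {V} 1≤V bnd →
    let bnd′ , w = se bnd
        g≤gV : g ≤ g * V
        g≤gV = ≤-trans (≤-reflexive (sym (*-identityʳ g))) (*-monoʳ-≤ g 1≤V)
        g+V≤ : g + V ≤ suc g * V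
        g+V≤ = ≤-trans (≤-reflexive (+-comm g V)) (+-monoʳ-≤ V g≤gV)
    in bounded-mono g+V≤ bnd′ , within-mono (≤-trans (m≤m+n g V) g+V≤) g+V≤ w

  -- The second command starts from a memory bounded by `suc k * V`, so its factor multiplies the
  -- first one; adding the two times gives the factor stated.
  linear-⨾ : ∀ {c d} → Linear c → Linear d → Linear (c ⨾ d)
  linear-⨾ (linear k lin) (linear k′ lin′) = linear (k + suc k′ * suc k) λ {V} 1≤V bnd →
    let bnd′ , w = lin 1≤V bnd
        bnd″ , w′ = lin′ (≤-trans 1≤V (m≤m+n V (k * V))) bnd′
        total : suc k * V + suc k′ * (suc k * V) ≡ suc (k + suc k′ * suc k) * V
        total = eq k k′ V
        left≤ = ≤-trans (m≤m+n (suc k * V) (suc k′ * (suc k * V))) (≤-reflexive total)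
        right≤ = ≤-trans (m≤n+m (suc k′ * (suc k * V)) (suc k * V)) (≤-reflexive total)
    in bounded-mono right≤ bnd″
     , within-mono (≤-reflexive total) ≤-refl (⊕-within (within-mono ≤-refl left≤ w) (within-mono ≤-refl right≤ w′))
    where
    eq : ∀ k k′ V → suc k * V + suc k′ * (suc k * V) ≡ suc (k + suc k′ * suc k) * V
    eq = solve-∀

  module _ (x : Scalar) {c : Cmd} {g : ℕ}
    (sc : ∀ {V σ} → Bounded V σ → Bounded (g + V) (exec c σ) × Within g (g + V) (cost c σ)) where

    private
      step : ℕ → State → State
      step v τ = exec c (setScalar x v τ)

      stepCost : ℕ → State → Cost
      stepCost v τ = cost c (setScalar x v τ)

    -- The bound W grows by g in each round, hence the induction over all W. A round takes 2 + g
    -- steps, with 2 for updating and testing the counter; the leading 1 is the last test.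
    iterate-bounded : ∀ {W σ} vs → All (_≤ W) vs → Bounded W σ →
      Bounded (length vs * g + W) (iterate step vs σ) ×
      Within (1 + length vs * (2 + g)) (length vs * g + W) (iterateCost step stepCost vs σ)
    iterate-bounded         []       []         bnd = bnd , op-within z≤n
    iterate-bounded {W} {σ} (v ∷ vs) (v≤ ∷ vs≤) bnd =
      let bnd₁ , w₁ = sc (setScalar-bounded x v≤ bnd)
          bnd₂ , w₂ = iterate-bounded vs (All.map (λ u≤ → ≤-trans u≤ (m≤n+m W g)) vs≤) bnd₁
          L = length vs
          size₂ = ≤-reflexive (eq₁ L g W)
          size₁ = ≤-trans (m≤n+m (g + W) (L * g)) size₂
          size₀ = ≤-trans (≤-trans v≤ (m≤n+m W g)) size₁
      in bounded-mono size₂ bnd₂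
       , within-mono (≤-reflexive (eq₂ L g)) ≤-refl
           (⊕-within (op-within size₀) (⊕-within (op-within z≤n)
             (⊕-within (within-mono ≤-refl size₁ w₁) (within-mono ≤-refl size₂ w₂))))
      where
      eq₁ : ∀ L g W → L * g + (g + W) ≡ g + L * g + W
      eq₁ = solve-∀
      eq₂ : ∀ L g → 1 + (1 + (g + (1 + L * (2 + g)))) ≡ 1 + (2 + g + L * (2 + g))
      eq₂ = solve-∀

    -- The number L of rounds is at most `suc (h + V)`, hence at most (h + 2)V, so both the total
    -- time and the total growth L * g are linear in V. In K, `suc h` covers evaluating the loop
    -- bounds, 1 the last test, and the product the rounds.
    loop-bounded : ∀ {h V σ} vs {κ} → 1 ≤ V → All (_≤ h + V) vs → length vs ≤ suc (h + V) →
      Within h (h + V) κ → Bounded V σ → (let K = suc h + (1 + suc (suc h) * (2 + g)) in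
      Bounded (K * V) (iterate step vs σ) × Within (K * V) (K * V) (κ ⊕ iterateCost step stepCost vs σ))
    loop-bounded {h} {V} vs 1≤V vs≤ L≤ w bnd =
      let bnd′ , w′ = iterate-bounded vs vs≤ (bounded-mono (m≤n+m V h) bnd)
          scale : ∀ m → m ≤ m * V
          scale m = ≤-trans (≤-reflexive (sym (*-identityʳ m))) (*-monoʳ-≤ m 1≤V)
          L = length vs
          h+V≤ : h + V ≤ suc h * V
          h+V≤ = ≤-trans (≤-reflexive (+-comm h V)) (+-monoʳ-≤ V (scale h))
          L≤′ : L ≤ suc (suc h) * V
          L≤′ = ≤-trans L≤ (+-mono-≤ 1≤V h+V≤)
          time≤ : h + (1 + L * (2 + g)) ≤ (suc h + (1 + suc (suc h) * (2 + g))) * V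
          time≤ = ≤-trans (+-mono-≤ (≤-trans (m≤m+n h V) h+V≤) (+-mono-≤ 1≤V (*-monoˡ-≤ (2 + g) L≤′)))
                          (≤-reflexive (eq h g V))
          size≤ : L * g + (h + V) ≤ (suc h + (1 + suc (suc h) * (2 + g))) * V
          size≤ = ≤-trans (+-mono-≤ (≤-trans (*-monoʳ-≤ L (m≤n+m g 2)) (*-monoˡ-≤ (2 + g) L≤′)) h+V≤)
                          (≤-trans (≤-reflexive (+-comm _ (suc h * V)))
                            (≤-trans (+-monoʳ-≤ (suc h * V) (m≤n+m _ V)) (≤-reflexive (eq h g V))))
      in bounded-mono size≤ bnd′
       , within-mono time≤ size≤ (⊕-within (within-mono ≤-refl (m≤n+m (h + V) (L * g)) w) w′)
      where
      eq : ∀ h g V → suc h * V + (V + suc (suc h) * V * (2 + g)) ≡ (suc h + (1 + suc (suc h) * (2 + g))) * V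
      eq = solve-∀

  ⊕-assoc : ∀ κ κ′ κ″ → (κ ⊕ κ′) ⊕ κ″ ≡ κ ⊕ κ′ ⊕ κ″
  ⊕-assoc κ κ′ κ″ with mkCost t e s ← κ | mkCost t′ e′ s′ ← κ′ | mkCost t″ e″ s″ ← κ″
    rewrite +-assoc t t′ t″ | ⊔-assoc e e′ e″ | ⊔-assoc s s′ s″ = refl

  private
    bounds : ∀ {e f} → SlowExpr e → SlowExpr f → ∃ λ h → ∀ {V σ} → Bounded V σ →
      ⟦ e ⟧ σ ≤ h + V × ⟦ f ⟧ σ ≤ h + V × Within h (h + V) (costᵉ e σ ⊕ costᵉ f σ)
    bounds (slow g se) (slow h sf) = g + h , λ bnd →
      let v≤ , w = se bnd
          v≤′ , w′ = sf bnd
      in ≤-trans v≤ (left g h) , ≤-trans v≤′ (right g h) ,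
         ⊕-within (within-mono ≤-refl (left g h) w) (within-mono ≤-refl (right g h) w′)

    below : ∀ {lo hi i} → i < suc hi ∸ lo → lo + i ≤ hi
    below {lo} {hi} i< = s≤s⁻¹ (<∸⇒+< lo (suc hi) i<)

  linear-upto : ∀ x {e f c} → SlowExpr e → SlowExpr f → Slow c → Linear (for x from e upto f loop c)
  linear-upto x {e} {f} {c} se sf (slow g sc) with h , both ← bounds {e} {f} se sf =
    linear (h + (1 + suc (suc h) * (2 + g))) λ {V} {σ} 1≤V bnd →
    let _ , hi≤ , w = both bnd
        lo = ⟦ e ⟧ σ
        hi = ⟦ f ⟧ σ
        vs = ascending lo hi
        vs≤ = All.applyUpTo⁺₁ (lo +_) (suc hi ∸ lo) λ i< → ≤-trans (below i<) hi≤
        L≤ = ≤-trans (≤-reflexive (length-applyUpTo (lo +_) (suc hi ∸ lo))) (≤-trans (m∸n≤m (suc hi) lo) (s≤s hi≤))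
        bnd′ , w′ = loop-bounded x {c} sc vs 1≤V vs≤ L≤ w bnd
    in bnd′ , subst (Within _ _) (⊕-assoc (costᵉ e σ) (costᵉ f σ) _) w′

  linear-downto : ∀ x {e f c} → SlowExpr e → SlowExpr f → Slow c → Linear (for x from e downto f loop c)
  linear-downto x {e} {f} {c} se sf (slow g sc) with h , both ← bounds {e} {f} se sf =
    linear (h + (1 + suc (suc h) * (2 + g))) λ {V} {σ} 1≤V bnd →
    let hi≤ , _ , w = both bnd
        hi = ⟦ e ⟧ σ
        lo = ⟦ f ⟧ σ
        vs = descending hi lo
        vs≤ = All.applyDownFrom⁺₁ (lo +_) (suc hi ∸ lo) λ i< → ≤-trans (below i<) hi≤
        L≤ = ≤-trans (≤-reflexive (length-applyDownFrom (lo +_) (suc hi ∸ lo))) (≤-trans (m∸n≤m (suc hi) lo) (s≤s hi≤))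
        bnd′ , w′ = loop-bounded x {c} sc vs 1≤V vs≤ L≤ w bnd
    in bnd′ , subst (Within _ _) (⊕-assoc (costᵉ e σ) (costᵉ f σ) _) w′

-- The linear bound for the decoding program.

module Resources where
  open DecodeRAM
  open Growth {6} {6}

  -- The derivation mirrors the program text. It goes through because every sum has a literal as
  -- second operand and every loop body is `Slow`.
  linear-program : Linear program
  linear-program =
    linear-⨾ (linear-⨾ (slow⇒linear (slow-≔ r (slow-lit 0)))
      (linear-downto i (slow-var n*) (slow-lit 1)
        (slow-when (slow-≤ (slow-var i) (slow-cell π (slow-var i)))
          (slow-⨾ (slow-≔ r (slow-⊞ (slow-var r) 1))
            (slow-⨾ (slow-⟨⟩≔ a (slow-var r) (slow-cell π (slow-var i)))
                    (slow-⟨⟩≔ b (slow-var r) (slow-var i)))))))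
    (linear-⨾ (linear-⨾ (slow⇒linear (slow-≔ m (slow-lit 0)))
      (linear-⨾ (linear-downto i (slow-var r) (slow-lit 1)
        (slow-when (slow-≠ (slow-cell a (slow-var i)) (slow-cell b (slow-var i)))
          (slow-⨾ (slow-≔ m (slow-⊞ (slow-var m) 1))
                  (slow-⟨⟩≔ πᵇ (slow-var m) (slow-cell a (slow-var i))))))
        (linear-upto i (slow-lit 1) (slow-var r)
          (slow-⨾ (slow-≔ m (slow-⊞ (slow-var m) 1))
                  (slow-⟨⟩≔ πᵇ (slow-var m) (slow-cell b (slow-var i)))))))
    (linear-⨾ (linear-⨾ (slow⇒linear (slow-≔ p (slow-lit 1)))
      (linear-upto i (slow-lit 2) (slow-var n*)
        (slow-when (slow-< (slow-cell πᵇ (slow-var p)) (slow-cell πᵇ (slow-var i)))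
          (slow-≔ p (slow-var i)))))
    (linear-⨾
      (linear-⨾
        (linear-upto i (slow-lit 1) (slow-⊟ (slow-var p) (slow-lit 1))
          (slow-⟨⟩≔ B′ (slow-cell πᵇ (slow-var i)) (slow-lit 1)))
        (linear-upto i (slow-var p) (slow-var n*)
          (slow-⟨⟩≔ B′ (slow-cell πᵇ (slow-var i)) (slow-lit 0))))
      (linear-⨾ (slow⇒linear (slow-≔ n (slow-⊟ (slow-var r) (slow-lit 1))))
        (linear-upto i (slow-⊞ (slow-var n) 1) (slow-⊟ (slow-var n*) (slow-lit 1))
          (slow-⟨⟩≔ out (slow-⊟ (slow-var i) (slow-var n)) (slow-cell B′ (slow-var i))))))))

  input-bounded : ∀ {xs V} → length xs ≤ V → (∀ k → xs ! k ≤ V) → Bounded V (input xs)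
  input-bounded {V = V} len≤ entries≤ =
      updateAt-all {P = _≤ V} (const 0) n* len≤ (λ _ → z≤n)
    , updateAt-all {P = λ f → ∀ k → f k ≤ V} (const (const 0)) π entries≤ (λ _ _ → z≤n)

-- Correctness of the RAM program

-- The invariant is indexed by the counter values already processed, and a step is told how they sit
-- in the whole range, from which the current value can be recovered.
iterate-invariant : ∀ {S : Set} (I : List ℕ → S → Set) {body : ℕ → S → S} {σ vs vs′} → vs ≡ vs′ →
  (∀ {ps v rest τ} → vs′ ≡ ps ++ v ∷ rest → I ps τ → I (ps ∷ʳ v) (body v τ)) →
  I [] σ → I vs′ (foldl (λ τ v → body v τ) σ vs)
iterate-invariant I {body} {vs = vs} refl step = go [] vs refl
  where
  go : ∀ ps rest {τ} → vs ≡ ps ++ rest → I ps τ → I vs (foldl (λ τ v → body v τ) τ rest)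
  go ps []         vs≡ inv = subst (λ qs → I qs _) (sym (trans vs≡ (++-identityʳ ps))) inv
  go ps (v ∷ rest) vs≡ inv = go (ps ∷ʳ v) rest (trans vs≡ (sym (++-assoc ps [ v ] rest))) (step vs≡ inv)

-- Trades a Boolean machine test for the decision it computes, after the invariant has identified
-- the values compared.
if-dec : ∀ {S : Set} (P : S → Set) {t} (d : Dec A) → t ≡ does d → ∀ {s s′} →
  (A → P s) → (¬ A → P s′) → P (if t then s else s′)
if-dec P (yes a) refl then-case else-case = then-case a
if-dec P (no ¬a) refl then-case else-case = else-case ¬a

written : ∀ k {x y : A} → (if k ≡ᵇ k then x else y) ≡ x
written k {x} {y} = cong (if_then x else y) (dec-true (k ≟ k) refl)

unwritten : ∀ {j k} {x y : A} → j ≢ k → (if j ≡ᵇ k then x else y) ≡ y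
unwritten {j = j} {k} {x} {y} j≢k = cong (if_then x else y) (dec-false (j ≟ k) j≢k)

-- Appending to an array. The length is `m + 1` and not `suc m` because the program computes it by
-- `⊞ lit 1`.
map-1⋯-∷ʳ : ∀ {f g : ℕ → A} m → (∀ k → k ≤ m → g k ≡ f k) → g (m + 1) ≡ x →
  map g (1⋯ (m + 1)) ≡ map f (1⋯ m) ∷ʳ x
map-1⋯-∷ʳ {f = f} {g} m same refl rewrite +-comm m 1 = trans
  (cong (map g) (sym (applyUpTo-∷ʳ suc m)))
  (trans (map-++ g (1⋯ m) [ suc m ])
    (cong (_∷ʳ g (suc m)) (map-cong-local (All.applyUpTo⁺₁ suc m λ i<m → same _ i<m))))

append-cell : ∀ (f : ℕ → ℕ) m x →
  map (λ j → if j ≡ᵇ m + 1 then x else f j) (1⋯ (m + 1)) ≡ map f (1⋯ m) ∷ʳ x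
append-cell f m x = map-1⋯-∷ʳ m (λ k k≤m → unwritten {k = m + 1} (<⇒≢ (≤-<-trans k≤m (m<m+n m z<s)))) (written (m + 1))

map-1⋯-length : ∀ {f : ℕ → A} {m} → map f (1⋯ m) ≡ xs → m ≡ length xs
map-1⋯-length {f = f} {m} refl = sym (trans (length-map f (1⋯ m)) (length-applyUpTo suc m))

map-1⋯-! : ∀ (f : ℕ → ℕ) {xs} → map f (1⋯ (length xs)) ≡ xs → ∀ {k} → k < length xs → f (suc k) ≡ xs ! suc k
map-1⋯-! f {xs} f≡ {k} k< = trans (sym (!-applyUpTo (f ∘ suc) k<))
  (cong (λ ys → ys ! suc k) (trans (sym (map-applyUpTo suc f (length xs))) f≡))

applyUpTo-split : ∀ (f : ℕ → A) {m} ps {v rest} → applyUpTo f m ≡ ps ++ v ∷ rest →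
  v ≡ f (length ps) × length ps < m
applyUpTo-split f {zero}  []       ()
applyUpTo-split f {zero}  (_ ∷ _)  ()
applyUpTo-split f {suc m} []       refl = refl , z<s
applyUpTo-split f {suc m} (p ∷ ps) eq with v≡ , len< ← applyUpTo-split (f ∘ suc) ps (∷-injectiveʳ eq) =
  v≡ , s<s len<

!-all : ∀ {P : ℕ → Set} {xs} → P 0 → All P xs → ∀ k → P (xs ! k)
!-all p0 []         k             = p0
!-all p0 (px ∷ pxs) zero          = p0
!-all p0 (px ∷ pxs) (suc zero)    = px
!-all p0 (px ∷ pxs) (suc (suc k)) = !-all p0 pxs (suc k)

-- Positions beyond the end hold the junk value 0 and are excluded by `0<M`.
max-position : ∀ {M xs ys} → 0 < M → All (_< M) xs → All (_< M) ys →
  ∀ k → M ≤ (xs ++ M ∷ ys) ! suc k → k ≡ length xs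
max-position 0<M []         ys< zero    M≤ = refl
max-position 0<M []         ys< (suc k) M≤ = contradiction M≤ (<⇒≱ (!-all 0<M ys< (suc k)))
max-position 0<M (x< ∷ xs<) ys< zero    M≤ = contradiction M≤ (<⇒≱ x<)
max-position 0<M (x< ∷ xs<) ys< (suc k) M≤ = cong suc (max-position 0<M xs< ys< k M≤)

-- Loop invariants of the five phases.

module Correctness where
  open DecodeRAM

  -- Carried through the earlier phases so that, when marking starts, every cell of `B′` already
  -- tells that nothing is marked.
  Cleared : State → Set
  Cleared σ = ∀ k → cell σ B′ k ≡ 0

  entries : State → Array → ℕ → List ℕ
  entries σ arr k = map (cell σ arr) (1⋯ k)

  module FindCycles (xs : List ℕ) where

    record Inv (ps : List ℕ) (σ : State) : Set where
      field
        length≡ : scalar σ n* ≡ length xs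
        input≡  : ∀ k → cell σ π k ≡ xs ! k
        cleared : Cleared σ
        cycles  : map (λ k → cell σ a k , cell σ b k) (1⋯ (scalar σ r)) ≡
                  map (λ y → xs ! y , y) (filter (λ y → y ≤? xs ! y) ps)

    open Inv public

    findCycles-correct : Inv (reverse (1⋯ (length xs))) (exec findCycles (input xs))
    findCycles-correct = iterate-invariant Inv (sym (reverse-applyUpTo suc (length xs))) step
      (record { length≡ = refl ; input≡ = λ _ → refl ; cleared = λ _ → refl ; cycles = refl })
      where
      P? : ∀ y → Dec (y ≤ xs ! y)
      P? y = y ≤? xs ! y
      step : ∀ {ps v rest τ} → reverse (1⋯ (length xs)) ≡ ps ++ v ∷ rest → Inv ps τ → Inv (ps ∷ʳ v) _
      step {ps} {v} {τ = τ} _ inv = if-dec (Inv (ps ∷ʳ v)) (P? v) (cong (v ≤ᵇ_) (input≡ inv v))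
        (λ v≤ → record
          { length≡ = length≡ inv
          ; input≡  = input≡ inv
          ; cleared = cleared inv
          ; cycles  = trans
              (map-1⋯-∷ʳ (scalar τ r)
                (λ k k≤ → let k≢ = <⇒≢ (≤-<-trans k≤ (m<m+n (scalar τ r) z<s)) in
                  cong₂ _,_ (unwritten {k = scalar τ r + 1} k≢) (unwritten {k = scalar τ r + 1} k≢))
                (cong₂ _,_ (trans (written (scalar τ r + 1)) (input≡ inv v)) (written (scalar τ r + 1))))
              (trans (cong (_∷ʳ (xs ! v , v)) (cycles inv)) (sym (trans
                (cong (map (λ y → xs ! y , y)) (trans (filter-∷ʳ P? ps v) (cong (filter P? ps ++_) (filter-accept P? v≤))))
                (map-++ (λ y → xs ! y , y) (filter P? ps) [ v ]))))
          })
        (λ v≰ → record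
          { length≡ = length≡ inv
          ; input≡  = input≡ inv
          ; cleared = cleared inv
          ; cycles  = trans (cycles inv) (cong (map (λ y → xs ! y , y))
              (sym (trans (filter-∷ʳ P? ps v) (trans (cong (filter P? ps ++_) (filter-reject P? v≰)) (++-identityʳ _)))))
          })

  module BuildBitonic {l : ℕ} (σ₀ : State) (length≡₀ : scalar σ₀ n* ≡ l) (cleared₀ : Cleared σ₀) where

    R = scalar σ₀ r
    A′ = cell σ₀ a
    B″ = cell σ₀ b

    ≠? : ∀ k → Dec (A′ k ≢ B″ k)
    ≠? k = ¬? (A′ k ≟ B″ k)

    -- Here f gives the expected contents of `πᵇ` in terms of the counters processed; varying f lets
    -- one record serve both loops.
    record Inv (f : List ℕ → List ℕ) (ps : List ℕ) (σ : State) : Set where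
      field
        length≡ : scalar σ n* ≡ l
        cleared : Cleared σ
        r≡      : scalar σ r ≡ R
        a≡      : ∀ k → cell σ a k ≡ A′ k
        b≡      : ∀ k → cell σ b k ≡ B″ k
        πᵇ≡     : entries σ πᵇ (scalar σ m) ≡ f ps

    open Inv public

    as bs : List ℕ → List ℕ
    as ps = map A′ (filter ≠? ps)
    bs ps = as (reverse (1⋯ R)) ++ map B″ ps

    buildBitonic-correct : Inv bs (1⋯ R) (exec buildBitonic σ₀)
    buildBitonic-correct = second _ (iterate-invariant (Inv as) (sym (reverse-applyUpTo suc R)) step
      (record { length≡ = length≡₀ ; cleared = cleared₀ ; r≡ = refl
              ; a≡ = λ _ → refl ; b≡ = λ _ → refl ; πᵇ≡ = refl }))
      where
      step : ∀ {ps v rest τ} → reverse (1⋯ R) ≡ ps ++ v ∷ rest → Inv as ps τ → Inv as (ps ∷ʳ v) _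
      step {ps} {v} {τ = τ} _ inv = if-dec (Inv as (ps ∷ʳ v)) (≠? v)
        (cong₂ (λ x y → not (x ≡ᵇ y)) (a≡ inv v) (b≡ inv v))
        (λ a≢b → record
          { length≡ = length≡ inv ; cleared = cleared inv ; r≡ = r≡ inv ; a≡ = a≡ inv ; b≡ = b≡ inv
          ; πᵇ≡ = trans (append-cell (cell τ πᵇ) (scalar τ m) (cell τ a v))
              (trans (cong₂ _∷ʳ_ (πᵇ≡ inv) (a≡ inv v)) (sym (trans
                (cong (map A′) (trans (filter-∷ʳ ≠? ps v) (cong (filter ≠? ps ++_) (filter-accept ≠? a≢b))))
                (map-++ A′ (filter ≠? ps) [ v ]))))
          })
        (λ a≡b → record
          { length≡ = length≡ inv ; cleared = cleared inv ; r≡ = r≡ inv ; a≡ = a≡ inv ; b≡ = b≡ inv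
          ; πᵇ≡ = trans (πᵇ≡ inv) (cong (map A′)
              (sym (trans (filter-∷ʳ ≠? ps v) (trans (cong (filter ≠? ps ++_) (filter-reject ≠? a≡b)) (++-identityʳ _)))))
          })
      second : ∀ σ → Inv as (reverse (1⋯ R)) σ → Inv bs (1⋯ R)
        (exec (for i from lit 1 upto var r loop (m ≔ var m ⊞ lit 1 ⨾ πᵇ ⟨ var m ⟩≔ b ⟨ var i ⟩)) σ)
      second σ inv₀ = iterate-invariant (Inv bs) (cong 1⋯ (r≡ inv₀))
        (λ {ps} {v} {_} {τ} _ inv → record
          { length≡ = length≡ inv ; cleared = cleared inv ; r≡ = r≡ inv ; a≡ = a≡ inv ; b≡ = b≡ inv
          ; πᵇ≡ = trans (append-cell (cell τ πᵇ) (scalar τ m) (cell τ b v))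
              (trans (cong₂ _∷ʳ_ (πᵇ≡ inv) (b≡ inv v))
                (trans (++-assoc (as (reverse (1⋯ R))) (map B″ ps) [ B″ v ])
                  (cong (as (reverse (1⋯ R)) ++_) (sym (map-++ B″ ps [ v ])))))
          })
        (record { length≡ = length≡ inv₀ ; cleared = cleared inv₀ ; r≡ = r≡ inv₀ ; a≡ = a≡ inv₀ ; b≡ = b≡ inv₀
                ; πᵇ≡ = trans (πᵇ≡ inv₀) (sym (++-identityʳ _)) })

    -- The first loop runs through the indices downwards, which is the reversal in `unfoldCycles`;
    -- filtering indices instead of pairs commutes with `map`.
    unfolded : ∀ {C} → map (λ k → A′ k , B″ k) (1⋯ R) ≡ C → bs (1⋯ R) ≡ unfoldCycles C
    unfolded refl = cong₂ _++_
      (trans (cong (map A′) (filter-reverse ≠? (1⋯ R))) (trans (reverse-map A′ (filter ≠? (1⋯ R)))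
        (cong reverse (trans (map-∘ (filter ≠? (1⋯ R)))
          (cong (map proj₁) (sym (filter-map-comm (λ ab → ¬? (proj₁ ab ≟ proj₂ ab)) (λ k → A′ k , B″ k) (1⋯ R))))))))
      (map-∘ (1⋯ R))

  module FindMax {l : ℕ} (σ₀ : State) (length≡₀ : scalar σ₀ n* ≡ suc l) (cleared₀ : Cleared σ₀) where

    Π = cell σ₀ πᵇ

    record Inv (ps : List ℕ) (σ : State) : Set where
      field
        length≡  : scalar σ n* ≡ suc l
        cleared  : Cleared σ
        r≡       : scalar σ r ≡ scalar σ₀ r
        πᵇ≡      : ∀ k → cell σ πᵇ k ≡ Π k
        p∈       : scalar σ p ∈ ps
        maximum  : All (λ k → Π k ≤ Π (scalar σ p)) ps

    open Inv public

    findMax-correct : Inv (1⋯ (suc l)) (exec findMax σ₀)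
    -- Position 1 counts as processed before the loop, and `1⋯ (suc l)` is 1 followed by the range
    -- of the loop.
    findMax-correct = iterate-invariant (Inv ∘ (1 ∷_)) (cong (ascending 2) length≡₀) step
      (record { length≡ = length≡₀ ; cleared = cleared₀ ; r≡ = refl ; πᵇ≡ = λ _ → refl
              ; p∈ = here refl ; maximum = ≤-refl ∷ [] })
      where
      step : ∀ {ps v rest τ} → ascending 2 (suc l) ≡ ps ++ v ∷ rest → Inv (1 ∷ ps) τ → Inv (1 ∷ ps ∷ʳ v) _
      step {ps} {v} {τ = τ} _ inv = if-dec (Inv (1 ∷ ps ∷ʳ v)) (Π (scalar τ p) <? Π v)
        (cong₂ _<ᵇ_ (πᵇ≡ inv (scalar τ p)) (πᵇ≡ inv v))
        (λ p<v → record
          { length≡ = length≡ inv ; cleared = cleared inv ; r≡ = r≡ inv ; πᵇ≡ = πᵇ≡ inv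
          ; p∈ = ∈-++⁺ʳ (1 ∷ ps) (here refl)
          ; maximum = All.∷ʳ⁺ (All.map (λ ≤p → ≤-trans ≤p (<⇒≤ p<v)) (maximum inv)) ≤-refl })
        (λ p≮v → record
          { length≡ = length≡ inv ; cleared = cleared inv ; r≡ = r≡ inv ; πᵇ≡ = πᵇ≡ inv
          ; p∈ = ∈-++⁺ˡ (p∈ inv)
          ; maximum = All.∷ʳ⁺ (maximum inv) (≮⇒≥ p≮v) })

  module MarkBits {l : ℕ} (X Y : List ℕ) (σ₀ : State)
    (length≡₀ : scalar σ₀ n* ≡ l) (cleared₀ : Cleared σ₀) (p≡₀ : scalar σ₀ p ≡ suc (length X))
    (|XY|≡l : length (X ++ Y) ≡ l)
    (πᵇ≡₀ : ∀ {k} → k < l → cell σ₀ πᵇ (suc k) ≡ (X ++ Y) ! suc k)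
    (disjoint : ∀ {x} → x ∈ X → x ∉ Y) where

    Π = cell σ₀ πᵇ

    record Inv (Z : List ℕ) (σ : State) : Set where
      field
        length≡ : scalar σ n* ≡ l
        r≡      : scalar σ r ≡ scalar σ₀ r
        p≡      : scalar σ p ≡ suc (length X)
        πᵇ≡     : ∀ k → cell σ πᵇ k ≡ Π k
        marked     : ∀ {j} → j ∈ Z → cell σ B′ j ≡ 1
        unmarked    : ∀ {j} → j ∉ Z → cell σ B′ j ≡ 0

    open Inv public

    private
      |X|≤l : length X ≤ l
      |X|≤l = subst (length X ≤_) |XY|≡l (length-++-≤ˡ X)

      firsts : map Π (1⋯ (length X)) ≡ X
      firsts = trans (map-cong-local (All.applyUpTo⁺₁ suc (length X) λ i< →
        trans (πᵇ≡₀ (<-≤-trans i< |X|≤l)) (!-++ˡ X Y i<))) (map-! X)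

      -- The addresses cleared by the second loop lie in `Y`. As `X` and `Y` are disjoint, that loop
      -- preserves `Inv X`.
      later : ∀ {ps v rest} → ascending (suc (length X)) l ≡ ps ++ v ∷ rest → Π v ∈ Y
      later {ps} eq with refl , i< ← applyUpTo-split (suc (length X) +_) ps eq =
        subst (_∈ Y) (sym (trans (πᵇ≡₀ k<l) (trans (cong ((X ++ Y) !_) (sym (+-suc (length X) (length ps))))
          (!-++ʳ X Y (length ps)))))
          (!-∈ Y (+-cancelˡ-< (length X) (length ps) (length Y)
            (subst (length X + length ps <_) (trans (sym |XY|≡l) (length-++ X)) k<l)))
        where
        k<l : length X + length ps < l
        k<l = s≤s⁻¹ (<∸⇒+< (suc (length X)) (suc l) i<)

    markOnes : Cmd
    markOnes = for i from lit 1 upto var p ⊟ lit 1 loop B′ ⟨ πᵇ ⟨ var i ⟩ ⟩≔ lit 1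

    markBits-correct : Inv X (exec markBits σ₀)
    markBits-correct = second (exec markOnes σ₀) (subst (λ Z → Inv Z (exec markOnes σ₀)) firsts
      (iterate-invariant (Inv ∘ map Π) (cong (λ k → 1⋯ (k ∸ 1)) p≡₀) step
        (record { length≡ = length≡₀ ; r≡ = refl ; p≡ = p≡₀ ; πᵇ≡ = λ _ → refl
                ; marked = λ () ; unmarked = λ {j} _ → cleared₀ j })))
      where
      step : ∀ {ps v rest τ} → 1⋯ (length X) ≡ ps ++ v ∷ rest → Inv (map Π ps) τ → Inv (map Π (ps ∷ʳ v)) _
      step {ps} {v} {τ = τ} _ inv rewrite map-++ Π ps [ v ] = record
        { length≡ = length≡ inv ; r≡ = r≡ inv ; p≡ = p≡ inv ; πᵇ≡ = πᵇ≡ inv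
        ; marked  = λ {j} j∈ → case j ≟ cell τ πᵇ v of λ where
            (yes refl) → written (cell τ πᵇ v)
            (no j≢)    → trans (unwritten {j = j} {cell τ πᵇ v} j≢) (marked inv ([ id , (λ { (here refl) → contradiction (sym (πᵇ≡ inv v)) j≢ }) ]′
                                                       (∈-++⁻ (map Π ps) j∈)))
        ; unmarked = λ {j} j∉ → trans
            (unwritten {j = j} {cell τ πᵇ v} (λ j≡ → j∉ (∈-++⁺ʳ (map Π ps) (here (trans j≡ (πᵇ≡ inv v))))))
            (unmarked inv (j∉ ∘ ∈-++⁺ˡ))
        }
      second : ∀ σ → Inv X σ → Inv X
        (exec (for i from var p upto var n* loop B′ ⟨ πᵇ ⟨ var i ⟩ ⟩≔ lit 0) σ)
      second σ inv₀ = iterate-invariant (λ _ → Inv X) (cong₂ ascending (p≡ inv₀) (length≡ inv₀))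
        (λ {ps} {v} {rest} {τ} eq inv → record
          { length≡ = length≡ inv ; r≡ = r≡ inv ; p≡ = p≡ inv ; πᵇ≡ = πᵇ≡ inv
          ; marked  = λ {j} j∈X → trans
              (unwritten {j = j} {cell τ πᵇ v} λ { refl → disjoint j∈X (subst (_∈ Y) (sym (πᵇ≡ inv v)) (later {ps} eq)) })
              (marked inv j∈X)
          ; unmarked = λ {j} j∉X → case j ≟ cell τ πᵇ v of λ where
              (yes refl) → written (cell τ πᵇ v)
              (no j≢)    → trans (unwritten {j = j} {cell τ πᵇ v} j≢) (unmarked inv j∉X)
          })
        inv₀

  module WriteResult (N : ℕ) (σ₀ : State)
    (length≡₀ : scalar σ₀ n* ≡ suc (N + N)) (r≡₀ : scalar σ₀ r ≡ suc N) where

    record Inv (ps : List ℕ) (σ : State) : Set where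
      field
        n≡   : scalar σ n ≡ N
        B′≡  : ∀ k → cell σ B′ k ≡ cell σ₀ B′ k
        out≡ : entries σ out (length ps) ≡ map (cell σ₀ B′) ps

    open Inv public

    writeResult-correct : Inv (applyUpTo ((N + 1) +_) N) (exec writeResult σ₀)
    writeResult-correct = iterate-invariant Inv
      (trans (cong₂ (λ k k′ → ascending (k ∸ 1 + 1) (k′ ∸ 1)) r≡₀ length≡₀)
             (cong (applyUpTo ((N + 1) +_)) (trans (cong (suc (N + N) ∸_) (+-comm N 1)) (m+n∸m≡n N N))))
      step
      (record { n≡ = cong (_∸ 1) r≡₀ ; B′≡ = λ _ → refl ; out≡ = refl })
      where
      step : ∀ {ps v rest τ} → applyUpTo ((N + 1) +_) N ≡ ps ++ v ∷ rest → Inv ps τ → Inv (ps ∷ʳ v) _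
      -- Matching turns the counter into `N + 1 + length ps`, so the index written is
      -- `length ps + 1`, the next free cell of `out`.
      step {ps} {τ = τ} eq inv with refl , _ ← applyUpTo-split ((N + 1) +_) ps eq = record
        { n≡   = n≡ inv
        ; B′≡  = B′≡ inv
        ; out≡ = trans (cong (λ k → map (λ j → if j ≡ᵇ v ∸ scalar τ n then cell τ B′ v else cell τ out j) (1⋯ k)) (length-++ ps))
            (trans (cong (λ k → map (λ j → if j ≡ᵇ k then cell τ B′ v else cell τ out j) (1⋯ (length ps + 1))) index)
            (trans (append-cell (cell τ out) (length ps) (cell τ B′ v))
            (trans (cong₂ _∷ʳ_ (out≡ inv) (B′≡ inv v)) (sym (map-++ (cell σ₀ B′) ps [ v ])))))
        }
        where
        v = N + 1 + length ps
        index : v ∸ scalar τ n ≡ length ps + 1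
        index = trans (cong₂ _∸_ (+-assoc N 1 (length ps)) (n≡ inv))
                      (trans (m+n∸m≡n N (1 + length ps)) (+-comm 1 (length ps)))

  -- Chaining the phases on the code of a bit string.

  module Stages (bits : List Bit) where

    open Padded bits using (X; M; R; involution) renaming (π to code)

    private
      module P = Padded bits
      N = length bits
      XY = X ++ M ∷ R

    |XY|≡M : length XY ≡ M
    |XY|≡M = trans (cong length (sym P.bitonic≡)) (trans (↭-length P.bitonic-perm) (length-applyUpTo suc M))

    record Found (σ : State) : Set where
      field
        length≡ : scalar σ n* ≡ M
        cleared : Cleared σ
        cycles  : map (λ k → cell σ a k , cell σ b k) (1⋯ (scalar σ r)) ≡ decreasingCycles code

    record Unfolded (σ : State) : Set where
      field
        length≡ : scalar σ n* ≡ M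
        cleared : Cleared σ
        r≡      : scalar σ r ≡ suc N
        πᵇ≡     : ∀ {k} → k < M → cell σ πᵇ (suc k) ≡ XY ! suc k

    record Located (σ : State) : Set where
      field
        length≡ : scalar σ n* ≡ M
        cleared : Cleared σ
        r≡      : scalar σ r ≡ suc N
        πᵇ≡     : ∀ {k} → k < M → cell σ πᵇ (suc k) ≡ XY ! suc k
        p≡      : scalar σ p ≡ suc (length X)

    record Marked (σ : State) : Set where
      field
        length≡ : scalar σ n* ≡ M
        r≡      : scalar σ r ≡ suc N
        B′≡     : entries σ B′ M ≡ map toℕ (padded bits)

    found : Found (exec findCycles (input code))
    found = record
      { length≡ = trans (length≡ inv) P.length-π≡M
      ; cleared = cleared inv
      ; cycles  = trans (cycles inv) (sym (decreasingCycles-involution code involution)) }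
      where
      open FindCycles code
      inv = findCycles-correct

    unfolded : ∀ {σ} → Found σ → Unfolded (exec buildBitonic σ)
    unfolded {σ} fnd = record
      { length≡ = I.length≡ inv
      ; cleared = I.cleared inv
      ; r≡      = trans (I.r≡ inv) (trans (map-1⋯-length cycles) P.length-cycles)
      ; πᵇ≡     = λ {k} k< → map-1⋯-! (cell σ′ πᵇ) list≡ (subst (k <_) (sym |XY|≡M) k<) }
      where
      open Found fnd
      module I = BuildBitonic σ length≡ cleared
      σ′ = exec buildBitonic σ
      inv : I.Inv I.bs (1⋯ I.R) σ′
      inv = I.buildBitonic-correct
      list≡′ : entries σ′ πᵇ (scalar σ′ m) ≡ XY
      list≡′ = trans (I.πᵇ≡ inv) (trans (I.unfolded cycles) (trans P.unfoldCycles≡ P.bitonic≡))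
      list≡ : entries σ′ πᵇ (length XY) ≡ XY
      -- The number of entries written is not counted by the invariant; the equation between the
      -- lists determines it.
      list≡ = subst (λ k → entries σ′ πᵇ k ≡ XY) (map-1⋯-length list≡′) list≡′

    located : ∀ {σ} → Unfolded σ → Located (exec findMax σ)
    located {σ} unf = record
      { length≡ = I.length≡ inv
      ; cleared = I.cleared inv
      ; r≡      = trans (I.r≡ inv) r≡
      ; πᵇ≡     = λ {k} k< → trans (I.πᵇ≡ inv (suc k)) (πᵇ≡ k<)
      ; p≡      = position _ (I.p∈ inv) (I.maximum inv) }
      where
      open Unfolded unf
      module I = FindMax σ length≡ cleared
      inv : I.Inv (1⋯ M) (exec findMax σ)
      inv = I.findMax-correct
      |X|<M : length X < M
      |X|<M = subst (length X <_) (trans (sym (length-++ X)) |XY|≡M) (m<m+n (length X) z<s)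
      at-max : cell σ πᵇ (suc (length X)) ≡ M
      at-max = trans (πᵇ≡ |X|<M) (trans (cong (XY !_) (+-comm 1 (length X))) (!-++ʳ X (M ∷ R) 0))
      position : ∀ q → q ∈ 1⋯ M → All (λ k → cell σ πᵇ k ≤ cell σ πᵇ q) (1⋯ M) → q ≡ suc (length X)
      position q q∈ largest with i , i< , refl ← ∈-applyUpTo⁻ suc q∈ =
        cong suc (max-position z<s P.X<M P.R<M i
          (subst₂ _≤_ at-max (πᵇ≡ i<) (All.lookup largest (∈-applyUpTo⁺ suc |X|<M))))

    marked : ∀ {σ} → Located σ → Marked (exec markBits σ)
    marked {σ} loc = record
      { length≡ = I.length≡ inv
      ; r≡      = trans (I.r≡ inv) r≡
      ; B′≡     = trans (map-cong bit (1⋯ M)) (trans (map-∘ (1⋯ M)) (cong (map toℕ)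
          (trans (cong₂ indicator (sym P.length-π≡M) (sym P.beforeMax≡)) P.indicator≡))) }
      where
      open Located loc
      module I = MarkBits X (M ∷ R) σ length≡ cleared p≡ |XY|≡M πᵇ≡ P.X-disjoint
      inv : I.Inv X (exec markBits σ)
      inv = I.markBits-correct
      bit : ∀ j → cell (exec markBits σ) B′ j ≡ toℕ (if does (_∈?_ _≟_ j X) then 1b else 0b)
      bit j with _∈?_ _≟_ j X
      ... | yes j∈X = I.marked inv j∈X
      ... | no  j∉X = I.unmarked inv j∉X

    -- Both sides are cut by the same `take N ∘ drop N`: among the cells this selects n + 1,...,2n,
    -- and in the padded string it selects the bits.
    message : ∀ f → map f (1⋯ M) ≡ map toℕ (padded bits) → map f (applyUpTo (suc N +_) N) ≡ map toℕ bits
    message f f≡ = trans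
      (sym (take-drop-middle (map f (1⋯ N)) (map f middle) (map f end)
        (trans (length-map f (1⋯ N)) (length-applyUpTo suc N))
        (trans (length-map f middle) (length-applyUpTo (suc N +_) N))))
      (trans (cong (take N ∘ drop N) (trans (sym split) (trans f≡ split′)))
        (take-drop-middle (map toℕ (replicate N 0b)) (map toℕ bits) (map toℕ [ 0b ])
          (trans (length-map toℕ (replicate N 0b)) (length-replicate N)) (length-map toℕ bits)))
      where
      middle end : List ℕ
      middle = applyUpTo (suc N +_) N
      end    = applyUpTo (λ j → suc N + (N + j)) 1
      eq : ∀ N → suc (N + N) ≡ N + (N + 1)
      eq = solve-∀
      split : map f (1⋯ M) ≡ map f (1⋯ N) ++ map f middle ++ map f end
      split = trans (cong (map f) (trans (cong 1⋯ (eq N)) (trans (applyUpTo-++ suc N (N + 1))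
          (cong (1⋯ N ++_) (applyUpTo-++ (suc N +_) N 1)))))
        (trans (map-++ f (1⋯ N) (middle ++ end)) (cong (map f (1⋯ N) ++_) (map-++ f middle end)))
      split′ : map toℕ (padded bits) ≡ map toℕ (replicate N 0b) ++ map toℕ bits ++ map toℕ [ 0b ]
      split′ = trans (map-++ toℕ (replicate N 0b) (bits ++ [ 0b ]))
        (cong (map toℕ (replicate N 0b) ++_) (map-++ toℕ bits [ 0b ]))

    written-out : ∀ {σ} → Marked σ → output (exec writeResult σ) ≡ map toℕ bits
    written-out {σ} mkd = begin
      output σ′                                             ≡⟨ map-applyUpTo suc (cell σ′ out) (scalar σ′ n) ⟨
      entries σ′ out (scalar σ′ n)                          ≡⟨ cong (entries σ′ out) n≡ ⟩
      entries σ′ out (length (applyUpTo ((N + 1) +_) N))    ≡⟨ I.out≡ inv ⟩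
      map (cell σ B′) (applyUpTo ((N + 1) +_) N)
        ≡⟨ cong (λ k → map (cell σ B′) (applyUpTo (k +_) N)) (+-comm N 1) ⟩
      map (cell σ B′) (applyUpTo (suc N +_) N)              ≡⟨ message (cell σ B′) B′≡ ⟩
      map toℕ bits                                          ∎
      where
      open ≡-Reasoning
      open Marked mkd
      module I = WriteResult N σ length≡ r≡
      σ′ = exec writeResult σ
      inv : I.Inv (applyUpTo ((N + 1) +_) N) σ′
      inv = I.writeResult-correct
      n≡ : scalar σ′ n ≡ length (applyUpTo ((N + 1) +_) N)
      n≡ = trans (I.n≡ inv) (sym (length-applyUpTo ((N + 1) +_) N))

    -- The equation keeps the type checker from running the program on
    -- encodeBits bits when the theorem is applied.
    output-correct : ∀ {xs} → xs ≡ code → output (exec program (input xs)) ≡ map toℕ bits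
    output-correct refl = written-out (marked (located (unfolded found)))

-- Bounds on the encoded input, the constant, and the assembly.

open DecodeRAM using (program; input; output; exec; cost; space)

!-zero : ∀ xs → xs ! 0 ≡ 0
!-zero []      = refl
!-zero (_ ∷ _) = refl

-- Bounds the memory from which the program starts. Inside the list the involution stays within its
-- range; outside, indexing yields 0.
encodeBits-entries≤ : ∀ bits {π} → π ≡ encodeBits bits → ∀ k → π ! k ≤ length π
encodeBits-entries≤ bits {π} _    zero    = ≤-trans (≤-reflexive (!-zero π)) z≤n
encodeBits-entries≤ bits {π} refl (suc k) with suc k ≤? length π
... | yes k< = proj₂ (∈-1⋯⁻ (proj₁ (Padded.involution bits (∈-1⋯⁺ z<s k<))))
... | no  k≮ = ≤-trans (≤-reflexive (!-beyond π (≮⇒≥ k≮))) z≤n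

binary-nonempty : ∀ w → w > 0 → 1 ≤ length (binary w)
binary-nonempty w w>0 with binary w | value-binary w
... | []    | 0≡w = contradiction 0≡w (<⇒≢ w>0)
... | _ ∷ _ | _   = s≤s z≤n

length-encode≤ : ∀ w → w > 0 → length (encode w) ≤ 3 * length (binary w)
-- From w > 0 the binary representation is nonempty, so 2n + 1 is at most 3n.
length-encode≤ w w>0 = ≤-trans (≤-reflexive (Padded.length-π (binary w)))
  (≤-trans (+-monoʳ-≤ (2 * length (binary w)) (binary-nonempty w w>0)) (≤-reflexive (eq (length (binary w)))))
  where
  eq : ∀ n → 2 * n + n ≡ 3 * n
  eq = solve-∀

-- The machine has 6 scalars and 6 arrays.
within⇒O : ∀ b {n} κ → 1 ≤ n → Within (b * n) (b * n) κ → (let c = 6 + 6 * (1 + b) in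
  time κ ≤ c * n × space κ ≤ c * n × size κ ≤ c * n)
within⇒O b {n} κ 1≤n (within t≤ e≤ s≤) =
    ≤-trans t≤ b≤
  , ≤-trans (+-mono-≤ (*-monoʳ-≤ 6 1≤n) (*-monoʳ-≤ 6 (+-mono-≤ 1≤n e≤))) (≤-reflexive (eq 6 b n))
  , ≤-trans s≤ b≤
  where
  eq : ∀ a b n → a * n + a * (n + b * n) ≡ (a + a * (1 + b)) * n
  eq = solve-∀
  b≤ : b * n ≤ (6 + 6 * (1 + b)) * n
  b≤ = *-monoˡ-≤ n (≤-trans (n≤1+n b) (≤-trans (m≤n*m (1 + b) 6) (m≤n+m (6 * (1 + b)) 6)))

LinearOn : ℕ → List ℕ → ℕ → Set
LinearOn c xs n =
    time (cost program (input xs)) ≤ c * n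
  × space (cost program (input xs)) ≤ c * n
  × size (cost program (input xs)) ≤ c * n

-- The starting bound V is 3n: it dominates the length and the entries of the input. The factor of
-- the program turns it into `suc k * 3 * n`, and `within⇒O` adds the fixed number of registers and
-- arrays.
linear⇒LinearOn : Growth.Linear program → ∃ λ c → ∀ xs n → 1 ≤ n →
  length xs ≤ 3 * n → (∀ j → xs ! j ≤ length xs) → LinearOn c xs n
linear⇒LinearOn (Growth.linear k bound) = 6 + 6 * (1 + suc k * 3) , λ xs n 1≤n len≤ entries≤ →
  within⇒O (suc k * 3) (cost program (input xs)) 1≤n
  (subst (λ v → Within v v (cost program (input xs))) (sym (*-assoc (suc k) 3 n))
    (proj₂ (bound {σ = input xs} (≤-trans 1≤n (m≤m+n n _))
      (Resources.input-bounded {xs} len≤ λ j → ≤-trans (entries≤ j) len≤))))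

resources : ∃ λ c → ∀ w → w > 0 → LinearOn c (encode w) (length (binary w))
resources = map₂ (λ bounded w w>0 → bounded (encode w) (length (binary w)) (binary-nonempty w w>0)
                    (length-encode≤ w w>0) (encodeBits-entries≤ (binary w) {encode w} refl))
                 (linear⇒LinearOn Resources.linear-program)

decode-encodeBits : ∀ bits {π} → π ≡ encodeBits bits → decode π ≡ value bits
decode-encodeBits bits refl = cong value (Padded.decodeBits≡ bits)

decode-encode : ∀ w → decode (encode w) ≡ w
decode-encode w = trans (decode-encodeBits (binary w) {encode w} refl) (value-binary w)

output-encode : ∀ w → output (exec program (input (encode w))) ≡ map toℕ (decodeBits (encode w))
output-encode w = trans (Correctness.Stages.output-correct (binary w) {encode w} refl)
                        (cong (map toℕ) (sym (Padded.decodeBits≡ (binary w))))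

theorem3p2 : ∃[ c ] ∀ (w n : ℕ) → w > 0 → length (binary w) ≡ n →
    decode (encode w) ≡ w
    × output (exec program (input (encode w))) ≡ map toℕ (decodeBits (encode w))
    × time (cost program (input (encode w))) ≤ c * n
    × space (cost program (input (encode w))) ≤ c * n
    × size (cost program (input (encode w))) ≤ c * n
theorem3p2 = map₂ (λ { bounded w _ w>0 refl → decode-encode w , output-encode w , bounded w w>0 }) resources
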